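{- For all integers $m\ge 1$ and $n\ge 2$, $\chi_{lt}(mC_6+P_3)=4$ and $\chi_{lt}(mC_6+nP_3)=2n+1$.
   Context: $G+H$ is the disjoint union of $G$ and $H$, $mG$ is the disjoint union of $m$ copies of $G$, $P_n$ is the path on $n$ vertices and $C_n$ is the cycle on $n$ vertices. For a finite simple graph $G=(V,E)$ of order $p$ and size $q$, a local total antimagic labeling is a bijection $f:V\cup E\to\{1,\dots,p+q\}$ such that, with weights $w_f(u)=\sum f(e)$ over all edges $e$ incident to $u$ for $u\in V$ (the label of $u$ itself is not included) and $w_f(uv)=f(u)+f(v)$ for $uv\in E$, one has: adjacent vertices have distinct weights, adjacent edges have distinct weights, and every vertex has a weight distinct from that of each of its incident edges. $\chi_{lt}(G)$ is the minimum, over all local total antimagic labelings $f$ of $G$, of the number of distinct values among all the vertex and edge weights. -}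

module Defs where

open import Data.Empty using (⊥-elim)
open import Data.Fin using (Fin; zero; suc; toℕ; inject₁; splitAt; join; _↑ˡ_; _↑ʳ_)
open import Data.Fin.Properties
  using (_≟_; toℕ-injective; toℕ-fromℕ<; toℕ<n; toℕ-inject₁; ↑ˡ-injective; ↑ʳ-injective;
         splitAt-↑ˡ; splitAt-↑ʳ; join-splitAt)
open import Data.List using (List; map; filter; length; deduplicate; allFin; _++_)
open import Data.Nat as ℕ using (ℕ; zero; suc; _+_; _≤_; _≤?_)
open import Data.Nat.DivMod using (_%_; _mod_; m%n<n; m<n⇒m%n≡m; n%n≡0)
open import Data.Nat.ListAction using (sum)
open import Data.Nat.Properties using (suc-injective; m≤n⇒m<n∨m≡n; 1+n≢n; m≢1+n+m; 0≢1+n)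
open import Data.Product using (Σ; ∃; _×_; _,_; proj₁; proj₂)
import Data.Product as ×
open import Data.Sum using (_⊎_; inj₁; inj₂; [_,_]′)
open import Function using (_∘_)
open import Function.Bundles using (_⤖_; Bijection)
open import Relation.Binary.PropositionalEquality
  using (_≡_; _≢_; refl; sym; trans; cong; subst)
open import Relation.Nullary using (Dec)
open import Relation.Nullary.Decidable using (True; _⊎-dec_)

------------------------------------------------------------------------
-- Finite simple graphs

-- The pair `ends e` lists the two endpoints of e in an arbitrary order;
-- the orientation carries no meaning.
record Graph : Set where
  field
    order : ℕ
    size  : ℕ

  Vertex : Set
  Vertex = Fin order

  Edge : Set
  Edge = Fin size

  field
    ends : Edge → Vertex × Vertex

  infix 4 _∈ᵉ_ _∈ᵉ?_

  _∈ᵉ_ : Vertex → Edge → Set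
  u ∈ᵉ e = u ≡ proj₁ (ends e) ⊎ u ≡ proj₂ (ends e)

  _∈ᵉ?_ : ∀ u e → Dec (u ∈ᵉ e)
  u ∈ᵉ? e = (u ≟ proj₁ (ends e)) ⊎-dec (u ≟ proj₂ (ends e))

  field
    no-loops     : ∀ e → proj₁ (ends e) ≢ proj₂ (ends e)
    no-parallels : ∀ {u v e e′} → u ≢ v →
                   u ∈ᵉ e → v ∈ᵉ e → u ∈ᵉ e′ → v ∈ᵉ e′ → e ≡ e′

  Adjacent : Vertex → Vertex → Set
  Adjacent u v = u ≢ v × ∃ λ e → u ∈ᵉ e × v ∈ᵉ e

  AdjacentEdges : Edge → Edge → Set
  AdjacentEdges e e′ = e ≢ e′ × ∃ λ u → u ∈ᵉ e × u ∈ᵉ e′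

  incidentEdges : Vertex → List Edge
  incidentEdges u = filter (u ∈ᵉ?_) (allFin size)

------------------------------------------------------------------------
-- Paths: edge i joins the vertices i and i + 1

P : ℕ → Graph
P zero = record
  { order = 0 ; size = 0 ; ends = λ () ; no-loops = λ () ; no-parallels = λ { {()} } }
P (suc k) = record
  { order = suc k
  ; size = k
  ; ends = λ i → inject₁ i , suc i
  ; no-loops = λ i eq → 1+n≢n (trans (sym (cong toℕ eq)) (toℕ-inject₁ i))
  ; no-parallels = simple
  }
  where
  bad : ∀ {i j : Fin k} → inject₁ i ≡ suc j → suc i ≢ inject₁ j
  bad {i} {j} p q = m≢1+n+m (toℕ i) {n = 1}
    (trans (trans (sym (toℕ-inject₁ i)) (cong toℕ p))
           (cong suc (trans (sym (toℕ-inject₁ j)) (sym (cong toℕ q)))))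

  simple : ∀ {u v : Fin (suc k)} {i j : Fin k} → u ≢ v →
           u ≡ inject₁ i ⊎ u ≡ suc i → v ≡ inject₁ i ⊎ v ≡ suc i →
           u ≡ inject₁ j ⊎ u ≡ suc j → v ≡ inject₁ j ⊎ v ≡ suc j → i ≡ j
  simple u≢v (inj₁ p) (inj₁ q) _ _ = ⊥-elim (u≢v (trans p (sym q)))
  simple u≢v (inj₂ p) (inj₂ q) _ _ = ⊥-elim (u≢v (trans p (sym q)))
  simple u≢v _ _ (inj₁ p) (inj₁ q) = ⊥-elim (u≢v (trans p (sym q)))
  simple u≢v _ _ (inj₂ p) (inj₂ q) = ⊥-elim (u≢v (trans p (sym q)))
  simple _ (inj₁ _) (inj₂ refl) (inj₁ _) (inj₂ refl) = refl
  simple _ (inj₂ refl) (inj₁ _) (inj₂ refl) (inj₁ _) = refl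
  simple _ (inj₁ p) (inj₂ q) (inj₂ r) (inj₁ s) = ⊥-elim (bad (trans (sym p) r) (trans (sym q) s))
  simple _ (inj₂ p) (inj₁ q) (inj₁ r) (inj₂ s) = ⊥-elim (bad (trans (sym q) s) (trans (sym p) r))

------------------------------------------------------------------------
-- Cycles on n ≥ 3 vertices: edge i joins the vertices i and i + 1 (mod n)

module _ {k : ℕ} where

  private
    n : ℕ
    n = 3 + k

  next : Fin n → Fin n
  next i = suc (toℕ i) mod n

  private
    toℕ-next : ∀ i → (toℕ (next i) ≡ suc (toℕ i)) ⊎ (suc (toℕ i) ≡ n × toℕ (next i) ≡ 0)
    toℕ-next i with m≤n⇒m<n∨m≡n (toℕ<n i)
    ... | inj₁ lt = inj₁ (trans (toℕ-fromℕ< (m%n<n (suc (toℕ i)) n)) (m<n⇒m%n≡m lt))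
    ... | inj₂ eq = inj₂ (eq , trans (toℕ-fromℕ< (m%n<n (suc (toℕ i)) n))
                                     (trans (cong (_% n) eq) (n%n≡0 n)))

  i≢next : ∀ i → i ≢ next i
  i≢next i eq with toℕ-next i
  ... | inj₁ p = 1+n≢n (trans (sym p) (sym (cong toℕ eq)))
  ... | inj₂ (p , q) = 0≢1+n (suc-injective (trans (cong suc (trans (sym q) (sym (cong toℕ eq)))) p))

  i≢next-next : ∀ i → i ≢ next (next i)
  i≢next-next i eq with toℕ-next i | toℕ-next (next i)
  ... | inj₁ p | inj₁ q = m≢1+n+m (toℕ i) {n = 1} (trans (cong toℕ eq) (trans q (cong suc p)))
  ... | inj₁ p | inj₂ (q , r) = 0≢1+n (suc-injective (suc-injective
        (trans (cong (2 +_) (sym (trans (cong toℕ eq) r))) (trans (cong suc (sym p)) q))))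
  ... | inj₂ (p , q) | inj₁ r = 0≢1+n (suc-injective (suc-injective
        (trans (cong suc (sym (trans (cong toℕ eq) (trans r (cong suc q))))) p)))
  ... | inj₂ (_ , q) | inj₂ (r , _) = 0≢1+n (suc-injective (trans (cong suc (sym q)) r))

C : (n : ℕ) {3≤n : True (3 ≤? n)} → Graph
C 0 {()}
C 1 {()}
C 2 {()}
C (suc (suc (suc k))) = record
  { order = 3 + k
  ; size = 3 + k
  ; ends = λ i → i , next i
  ; no-loops = i≢next
  ; no-parallels = simple
  }
  where
  bad : ∀ {i j : Fin (3 + k)} → i ≡ next j → next i ≢ j
  bad {i} p q = i≢next-next i (trans p (cong next (sym q)))

  simple : ∀ {u v i j : Fin (3 + k)} → u ≢ v →
           u ≡ i ⊎ u ≡ next i → v ≡ i ⊎ v ≡ next i →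
           u ≡ j ⊎ u ≡ next j → v ≡ j ⊎ v ≡ next j → i ≡ j
  simple u≢v (inj₁ p) (inj₁ q) _ _ = ⊥-elim (u≢v (trans p (sym q)))
  simple u≢v (inj₂ p) (inj₂ q) _ _ = ⊥-elim (u≢v (trans p (sym q)))
  simple u≢v _ _ (inj₁ p) (inj₁ q) = ⊥-elim (u≢v (trans p (sym q)))
  simple u≢v _ _ (inj₂ p) (inj₂ q) = ⊥-elim (u≢v (trans p (sym q)))
  simple _ (inj₁ p) (inj₂ _) (inj₁ q) (inj₂ _) = trans (sym p) q
  simple _ (inj₂ _) (inj₁ p) (inj₂ _) (inj₁ q) = trans (sym p) q
  simple _ (inj₁ p) (inj₂ q) (inj₂ r) (inj₁ s) = ⊥-elim (bad (trans (sym p) r) (trans (sym q) s))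
  simple _ (inj₂ p) (inj₁ q) (inj₁ r) (inj₂ s) = ⊥-elim (bad (trans (sym q) s) (trans (sym p) r))

------------------------------------------------------------------------
-- Disjoint unions

infixr 6 _⊕_
infixr 7 _·_

_⊕_ : Graph → Graph → Graph
G ⊕ H = record
  { order = G.order + H.order
  ; size = G.size + H.size
  ; ends = λ e → ends⊎ (splitAt G.size e)
  ; no-loops = λ e → loopless (splitAt G.size e)
  ; no-parallels = λ {_} {_} {e} {e′} u≢v p q r s →
      trans (sym (join-splitAt G.size H.size e))
            (trans (cong (join G.size H.size)
                         (simple (splitAt G.size e) (splitAt G.size e′) u≢v p q r s))
                   (join-splitAt G.size H.size e′))
  }
  where
  module G = Graph G
  module H = Graph H

  ends⊎ : G.Edge ⊎ H.Edge → Fin (G.order + H.order) × Fin (G.order + H.order)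
  ends⊎ = [ ×.map (_↑ˡ H.order) (_↑ˡ H.order) ∘ G.ends
          , ×.map (G.order ↑ʳ_) (G.order ↑ʳ_) ∘ H.ends ]′

  In : Fin (G.order + H.order) → G.Edge ⊎ H.Edge → Set
  In u x = u ≡ proj₁ (ends⊎ x) ⊎ u ≡ proj₂ (ends⊎ x)

  loopless : ∀ x → proj₁ (ends⊎ x) ≢ proj₂ (ends⊎ x)
  loopless (inj₁ a) eq = G.no-loops a (↑ˡ-injective H.order _ _ eq)
  loopless (inj₂ b) eq = H.no-loops b (↑ʳ-injective G.order _ _ eq)

  inˡ : ∀ {u a} → In u (inj₁ a) → ∃ λ x → u ≡ x ↑ˡ H.order × x G.∈ᵉ a
  inˡ (inj₁ p) = _ , p , inj₁ refl
  inˡ (inj₂ p) = _ , p , inj₂ refl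

  inʳ : ∀ {u b} → In u (inj₂ b) → ∃ λ y → u ≡ G.order ↑ʳ y × y H.∈ᵉ b
  inʳ (inj₁ p) = _ , p , inj₁ refl
  inʳ (inj₂ p) = _ , p , inj₂ refl

  disjoint : ∀ {u a b} {A : Set} → In u (inj₁ a) → In u (inj₂ b) → A
  disjoint p q with inˡ p | inʳ q
  ... | x , refl , _ | y , eq , _
    with trans (sym (splitAt-↑ˡ G.order x H.order))
               (trans (cong (splitAt G.order) eq) (splitAt-↑ʳ G.order H.order y))
  ... | ()

  simple : ∀ {u v} x y → u ≢ v → In u x → In v x → In u y → In v y → x ≡ y
  simple (inj₁ a) (inj₂ b) _ p _ r _ = disjoint p r
  simple (inj₂ b) (inj₁ a) _ p _ r _ = disjoint r p
  simple (inj₁ a) (inj₁ b) u≢v p q r s with inˡ p | inˡ q | inˡ r | inˡ s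
  ... | x , refl , x∈a | y , refl , y∈a | x′ , eˣ , x′∈b | y′ , eʸ , y′∈b =
    cong inj₁ (G.no-parallels (u≢v ∘ cong (_↑ˡ H.order)) x∈a y∈a
      (subst (G._∈ᵉ b) (sym (↑ˡ-injective H.order x x′ eˣ)) x′∈b)
      (subst (G._∈ᵉ b) (sym (↑ˡ-injective H.order y y′ eʸ)) y′∈b))
  simple (inj₂ a) (inj₂ b) u≢v p q r s with inʳ p | inʳ q | inʳ r | inʳ s
  ... | x , refl , x∈a | y , refl , y∈a | x′ , eˣ , x′∈b | y′ , eʸ , y′∈b =
    cong inj₂ (H.no-parallels (u≢v ∘ cong (G.order ↑ʳ_)) x∈a y∈a
      (subst (H._∈ᵉ b) (sym (↑ʳ-injective G.order x x′ eˣ)) x′∈b)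
      (subst (H._∈ᵉ b) (sym (↑ʳ-injective G.order y y′ eʸ)) y′∈b))

_·_ : ℕ → Graph → Graph
zero  · G = P 0
suc m · G = G ⊕ m · G

------------------------------------------------------------------------
-- Local total antimagic labelings

module _ (G : Graph) where
  open Graph G

  Labeling : Set
  Labeling = (Vertex ⊎ Edge) ⤖ Fin (order + size)

  module _ (f : Labeling) where

    -- Fin (p + q) is {0, …, p + q - 1}; the labels are {1, …, p + q}.
    label : Vertex ⊎ Edge → ℕ
    label x = suc (toℕ (Bijection.to f x))

    vertexWeight : Vertex → ℕ
    vertexWeight u = sum (map (label ∘ inj₂) (incidentEdges u))

    edgeWeight : Edge → ℕ
    edgeWeight e = label (inj₁ (proj₁ (ends e))) + label (inj₁ (proj₂ (ends e)))

    record IsLocalTotalAntimagic : Set where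
      field
        vertices-distinct : ∀ {u v} → Adjacent u v → vertexWeight u ≢ vertexWeight v
        edges-distinct    : ∀ {e e′} → AdjacentEdges e e′ → edgeWeight e ≢ edgeWeight e′
        incident-distinct : ∀ {u e} → u ∈ᵉ e → vertexWeight u ≢ edgeWeight e

    weights : List ℕ
    weights = map vertexWeight (allFin order) ++ map edgeWeight (allFin size)

    numberOfWeights : ℕ
    numberOfWeights = length (deduplicate ℕ._≟_ weights)

IsMinimum : (ℕ → Set) → ℕ → Set
IsMinimum A k = A k × (∀ {j} → A j → k ≤ j)

-- χₗₜ is a relation rather than an ℕ-valued function on all graphs:
-- some graphs (K₂, for instance) have no local total antimagic labeling.
χₗₜ_≔_ : Graph → ℕ → Set
χₗₜ G ≔ k = IsMinimum (λ j → Σ (Labeling G) λ f →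
                         IsLocalTotalAntimagic G f × numberOfWeights G f ≡ j) k

infix 4 χₗₜ_≔_

{-# OPTIONS --safe #-}

-- Lower bounds.  The weight of a leaf of a P₃ is the label of its edge, so the 2n edge labels
-- of the paths are weights; the centre next to the largest of them has a larger weight still.
-- For n = 1, if there were only three weights, they would be a, b, a + b with a and b the edge
-- labels of the path; a proper colouring of the vertices and edges of C₆ with three colours has
-- an edge of weight a + b whose neighbouring edges have weights a and b, which is impossible
-- for positive labels.
--
-- Upper bounds.  Put N = 12m + 5n and B = 12m + 3n + 1.  For 0 ≤ i < n, the edges of the i-th
-- path get the labels N - i and B + i, of constant sum, and its vertices get 1 + 2i, B - 1 - i
-- and 2 + 2i, so that its edges have weights B + i and B + i + 1.  The labels
-- 2n + 1, …, 2n + 12m are left for the cycles: cut into triples of consecutive numbers, paired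
-- by reflection in the centre of this interval, two such pairs label a C₆ with the weights
-- B + n - 1, B + n and B + n + 1.

module Submission where

open import Defs
open import Data.Empty using (⊥; ⊥-elim)
open import Data.Fin as Fin using (Fin; zero; suc; toℕ; fromℕ<; punchOut; splitAt; _↑ˡ_; _↑ʳ_)
open import Data.Fin.Patterns using (0F; 1F; 2F; 3F; 4F; 5F)
open import Data.Fin.Properties as Finₚ
  using (all?; splitAt-↑ˡ; splitAt-↑ʳ; join-splitAt; ↑ˡ-injective; ↑ʳ-injective;
         toℕ-injective; toℕ-fromℕ<; toℕ<n; punchOut-injective; injective⇒≤)
open import Data.List using (List; []; _∷_; map; length; lookup; allFin; upTo; deduplicate)
open import Data.List.Extrema.Nat using (argmax; f[xs]≤f[argmax])
open import Data.List.Membership.Propositional using (_∈_)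
open import Data.List.Membership.Propositional.Properties
  using (∈-lookup; ∈-map⁺; ∈-map⁻; ∈-filter⁺; ∈-filter⁻; ∈-allFin; ∈-upTo⁺;
         ∈-++⁺ˡ; ∈-++⁺ʳ; ∈-++⁻; ∈-deduplicate⁺; ∈-deduplicate⁻)
open import Data.List.Membership.Propositional.Properties.WithK using (unique∧set⇒bag)
open import Data.List.Properties using (length-map; length-upTo; length-tabulate; map-∘; map-cong)
open import Data.List.Relation.Binary.BagAndSetEquality using (∼bag⇒↭)
open import Data.List.Relation.Binary.Permutation.Propositional using (_↭_)
import Data.List.Relation.Binary.Permutation.Propositional.Properties as Perm
open import Data.List.Relation.Binary.Subset.Propositional using (_⊆_)
open import Data.List.Relation.Unary.All as All using (All; []; _∷_)
open import Data.List.Relation.Unary.AllPairs using ([]; _∷_)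
open import Data.List.Relation.Unary.Any using (here; there; index)
open import Data.List.Relation.Unary.Unique.Propositional using (Unique)
import Data.List.Relation.Unary.Unique.Propositional.Properties as Unique
import Data.List.Relation.Unary.Unique.DecPropositional.Properties as DecUnique
import Data.List.Membership.Setoid.Properties as Membership
open import Data.Nat as ℕ using (ℕ; zero; suc; _+_; _*_; _%_; _≤_; _<_; z≤n; s≤s; NonZero)
open import Data.List.Membership.DecPropositional ℕ._≟_ using (_∈?_)
open import Data.Nat.DivMod using ([m+kn]%n≡m%n; m<n⇒m%n≡m)
open import Data.Nat.ListAction using (sum)
open import Data.Nat.ListAction.Properties using (sum-↭)
open import Data.Nat.Properties as ℕₚ
open import Data.Nat.Tactic.RingSolver using (solve-∀)
open import Data.Product as × using (Σ; ∃; ∃₂; _×_; _,_; proj₁; proj₂)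
open import Data.Sum as ⊎ using (_⊎_; inj₁; inj₂; [_,_]′)
open import Data.Sum.Properties using (inj₂-injective)
open import Function using (_∘_; id)
open import Function.Bundles using (Bijection; mk⇔; mk⤖)
open import Function.Definitions using (Injective; Surjective)
open import Relation.Binary.PropositionalEquality
open import Relation.Nullary using (yes; no; contradiction)
open import Relation.Nullary.Decidable using (from-yes; _→-dec_; ¬?)

-- Counting in duplicate-free lists and finite sets.

lookup-injective : ∀ {A : Set} {xs : List A} → Unique xs →
                   ∀ i j → lookup xs i ≡ lookup xs j → i ≡ j
lookup-injective (x∉ ∷ _)  zero    zero    _  = refl
lookup-injective (x∉ ∷ _)  zero    (suc j) eq = contradiction eq (All.lookup x∉ (∈-lookup j))
lookup-injective (x∉ ∷ _)  (suc i) zero    eq = contradiction (sym eq) (All.lookup x∉ (∈-lookup i))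
lookup-injective (_ ∷ uxs) (suc i) (suc j) eq = cong suc (lookup-injective uxs i j eq)

-- Pigeonhole: sending each position of `xs` to the position of its element in `ys` is injective
-- because `xs` has no repetitions.
unique-⊆⇒length-≤ : ∀ {A : Set} {xs ys : List A} → Unique xs → xs ⊆ ys → length xs ≤ length ys
unique-⊆⇒length-≤ {A} {xs} uxs xs⊆ys = injective⇒≤ {f = λ i → index (xs⊆ys (∈-lookup i))}
  λ {i} {j} eq → lookup-injective uxs i j
    (Membership.index-injective (setoid A) (xs⊆ys (∈-lookup i)) (xs⊆ys (∈-lookup j)) eq)

-- Sums ignore order, so vertex weights in different graphs can be compared without tracking how the
-- two enumerations of incident edges are ordered.
unique-sets⇒↭ : ∀ {A : Set} {xs ys : List A} → Unique xs → Unique ys → xs ⊆ ys → ys ⊆ xs → xs ↭ ys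
unique-sets⇒↭ uxs uys xs⊆ys ys⊆xs = ∼bag⇒↭ (unique∧set⇒bag uxs uys (mk⇔ xs⊆ys ys⊆xs))

-- If `y` were missed, punching it out of the codomain would inject `Fin (suc n)` into `Fin n`.
injective⇒surjective : ∀ {n} {f : Fin n → Fin n} → Injective _≡_ _≡_ f → ∀ y → ∃ λ x → f x ≡ y
injective⇒surjective {suc n} {f} inj y with Finₚ.any? (λ x → f x Finₚ.≟ y)
... | yes hit = hit
... | no miss = contradiction (injective⇒≤ {f = λ x → punchOut (avoid x)} λ {i} {j} eq →
                                inj (punchOut-injective (avoid i) (avoid j) eq))
                              1+n≰n
  where
  avoid : ∀ x → y ≢ f x
  avoid x eq = miss (x , sym eq)

-- Weights, proper total colourings, and components of a graph.

Element : Graph → Set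
Element G = Graph.Vertex G ⊎ Graph.Edge G

-- Defined for arbitrary numbers on the elements, since the labels of one component need not fill an
-- initial segment. With `label G f` in place of `g` it unfolds to `vertexWeight` and `edgeWeight`.
weight : (G : Graph) → (Element G → ℕ) → Element G → ℕ
weight G g (inj₁ u) = sum (map (g ∘ inj₂) (Graph.incidentEdges G u))
weight G g (inj₂ e) = g (inj₁ (proj₁ (Graph.ends G e))) + g (inj₁ (proj₂ (Graph.ends G e)))

weight-≗ : ∀ G {g g′ : Element G → ℕ} → (∀ x → g x ≡ g′ x) → ∀ x → weight G g x ≡ weight G g′ x
weight-≗ G g≗g′ (inj₁ u) = cong sum (map-cong (g≗g′ ∘ inj₂) (Graph.incidentEdges G u))
weight-≗ G g≗g′ (inj₂ e) = cong₂ _+_ (g≗g′ (inj₁ _)) (g≗g′ (inj₁ _))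

record Proper (G : Graph) (c : Element G → ℕ) : Set where
  open Graph G
  field
    vertices : ∀ {u v} → Adjacent u v → c (inj₁ u) ≢ c (inj₁ v)
    edges    : ∀ {e e′} → AdjacentEdges e e′ → c (inj₂ e) ≢ c (inj₂ e′)
    incident : ∀ {u e} → u ∈ᵉ e → c (inj₁ u) ≢ c (inj₂ e)

-- An embedding of `G` as a union of connected components of `K`: `incident-edge` forbids further
-- edges of `K` at the image, and this is what makes the vertex weights agree.
record Component (G K : Graph) : Set where
  private
    module G = Graph G
    module K = Graph K
  field
    vertex           : G.Vertex → K.Vertex
    edge             : G.Edge → K.Edge
    ends-edge        : ∀ e → K.ends (edge e) ≡ ×.map vertex vertex (G.ends e)
    vertex-injective : ∀ {u v} → vertex u ≡ vertex v → u ≡ v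
    edge-injective   : ∀ {e e′} → edge e ≡ edge e′ → e ≡ e′
    incident-edge    : ∀ {u e} → vertex u K.∈ᵉ e → ∃ λ e′ → e ≡ edge e′

  element : Element G → Element K
  element = ⊎.map vertex edge

  edge-vertex : ∀ {v e} → v K.∈ᵉ edge e → ∃ λ u → v ≡ vertex u × u G.∈ᵉ e
  edge-vertex {e = e} v∈e rewrite ends-edge e with v∈e
  ... | inj₁ p = _ , p , inj₁ refl
  ... | inj₂ p = _ , p , inj₂ refl

  ∈ᵉ⁺ : ∀ {u e} → u G.∈ᵉ e → vertex u K.∈ᵉ edge e
  ∈ᵉ⁺ {e = e} u∈e rewrite ends-edge e = ⊎.map (cong vertex) (cong vertex) u∈e

  ∈ᵉ⁻ : ∀ {u e} → vertex u K.∈ᵉ edge e → u G.∈ᵉ e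
  ∈ᵉ⁻ u∈e with edge-vertex u∈e
  ... | _ , eq , u′∈e = subst (G._∈ᵉ _) (sym (vertex-injective eq)) u′∈e

  incidentEdges-↭ : ∀ u → K.incidentEdges (vertex u) ↭ map edge (G.incidentEdges u)
  incidentEdges-↭ u = unique-sets⇒↭
    (Unique.filter⁺ (vertex u K.∈ᵉ?_) (Unique.allFin⁺ K.size))
    (Unique.map⁺ edge-injective (Unique.filter⁺ (u G.∈ᵉ?_) (Unique.allFin⁺ G.size)))
    forth back
    where
    forth : K.incidentEdges (vertex u) ⊆ map edge (G.incidentEdges u)
    forth e∈ with proj₂ (∈-filter⁻ (vertex u K.∈ᵉ?_) {xs = allFin K.size} e∈)
    ... | u∈e with incident-edge u∈e
    ... | e′ , refl = ∈-map⁺ edge (∈-filter⁺ (u G.∈ᵉ?_) (∈-allFin e′) (∈ᵉ⁻ u∈e))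

    back : map edge (G.incidentEdges u) ⊆ K.incidentEdges (vertex u)
    back e∈ with ∈-map⁻ edge e∈
    ... | e′ , e′∈ , refl = ∈-filter⁺ (vertex u K.∈ᵉ?_) (∈-allFin _)
                              (∈ᵉ⁺ (proj₂ (∈-filter⁻ (u G.∈ᵉ?_) {xs = allFin G.size} e′∈)))

  weight-element : ∀ {g g′} → (∀ x → g (element x) ≡ g′ x) →
                   ∀ x → weight K g (element x) ≡ weight G g′ x
  weight-element {g} {g′} g≗g′ (inj₁ u) = begin
    sum (map (g ∘ inj₂) (K.incidentEdges (vertex u)))
      ≡⟨ sum-↭ (Perm.map⁺ (g ∘ inj₂) (incidentEdges-↭ u)) ⟩
    sum (map (g ∘ inj₂) (map edge (G.incidentEdges u)))
      ≡⟨ cong sum (sym (map-∘ (G.incidentEdges u))) ⟩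
    sum (map (g ∘ inj₂ ∘ edge) (G.incidentEdges u))
      ≡⟨ cong sum (map-cong (g≗g′ ∘ inj₂) (G.incidentEdges u)) ⟩
    sum (map (g′ ∘ inj₂) (G.incidentEdges u)) ∎
    where open ≡-Reasoning
  weight-element g≗g′ (inj₂ e) rewrite ends-edge e = cong₂ _+_ (g≗g′ (inj₁ _)) (g≗g′ (inj₁ _))

  restrict-proper : ∀ {c} → Proper K c → Proper G (c ∘ element)
  restrict-proper proper = record
    { vertices = λ (u≢v , e , u∈e , v∈e) →
        Proper.vertices proper (u≢v ∘ vertex-injective , edge e , ∈ᵉ⁺ u∈e , ∈ᵉ⁺ v∈e)
    ; edges    = λ (e≢e′ , u , u∈e , u∈e′) →
        Proper.edges proper (e≢e′ ∘ edge-injective , vertex u , ∈ᵉ⁺ u∈e , ∈ᵉ⁺ u∈e′)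
    ; incident = Proper.incident proper ∘ ∈ᵉ⁺
    }

  -- Here the vertices range over all of `K`: one edge inside the component forces its endpoints,
  -- and through `incident-edge` the edges meeting it, to lie there too.
  vertices-at : ∀ {c} → Proper G (c ∘ element) → ∀ {u v e} → u ≢ v →
                u K.∈ᵉ edge e → v K.∈ᵉ edge e → c (inj₁ u) ≢ c (inj₁ v)
  vertices-at proper u≢v u∈e v∈e with edge-vertex u∈e | edge-vertex v∈e
  ... | _ , refl , x∈e | _ , refl , y∈e = Proper.vertices proper (u≢v ∘ cong vertex , _ , x∈e , y∈e)

  edges-at : ∀ {c} → Proper G (c ∘ element) → ∀ {u e e′} → edge e ≢ e′ →
             u K.∈ᵉ edge e → u K.∈ᵉ e′ → c (inj₂ (edge e)) ≢ c (inj₂ e′)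
  edges-at proper e≢e′ u∈e u∈e′ with edge-vertex u∈e
  ... | _ , refl , x∈e with incident-edge u∈e′
  ... | _ , refl = Proper.edges proper (e≢e′ ∘ cong edge , _ , x∈e , ∈ᵉ⁻ u∈e′)

  incident-at : ∀ {c} → Proper G (c ∘ element) → ∀ {u e} →
                u K.∈ᵉ edge e → c (inj₁ u) ≢ c (inj₂ (edge e))
  incident-at proper u∈e with edge-vertex u∈e
  ... | _ , refl , x∈e = Proper.incident proper x∈e

open Component using (element)

infixr 9 _∘ᶜ_

_∘ᶜ_ : ∀ {G K L} → Component K L → Component G K → Component G L
_∘ᶜ_ {G} {L = L} ψ φ = record
  { vertex           = ψ.vertex ∘ φ.vertex
  ; edge             = ψ.edge ∘ φ.edge
  ; ends-edge        = λ e → trans (ψ.ends-edge (φ.edge e))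
                               (cong (×.map ψ.vertex ψ.vertex) (φ.ends-edge e))
  ; vertex-injective = φ.vertex-injective ∘ ψ.vertex-injective
  ; edge-injective   = φ.edge-injective ∘ ψ.edge-injective
  ; incident-edge    = incident
  }
  where
  module φ = Component φ
  module ψ = Component ψ

  incident : ∀ {u e} → Graph._∈ᵉ_ L (ψ.vertex (φ.vertex u)) e → ∃ λ e′ → e ≡ ψ.edge (φ.edge e′)
  incident {u} u∈e with ψ.incident-edge u∈e
  ... | _ , refl with φ.incident-edge (ψ.∈ᵉ⁻ u∈e)
  ... | e′ , refl = e′ , refl

-- Disjoint unions: glued labels and their weights.

↑ˡ≢↑ʳ : ∀ {m n} {i : Fin m} {j : Fin n} → i ↑ˡ n ≢ m ↑ʳ j
↑ˡ≢↑ʳ {m} {n} {i} {j} eq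
  with trans (sym (splitAt-↑ˡ m i n)) (trans (cong (splitAt m) eq) (splitAt-↑ʳ m n j))
... | ()

data Split {m n : ℕ} : Fin (m + n) → Set where
  left  : ∀ i → Split (i ↑ˡ n)
  right : ∀ j → Split (m ↑ʳ j)

split : ∀ m {n} (k : Fin (m + n)) → Split {m} {n} k
split m {n} k with splitAt m k | join-splitAt m n k
... | inj₁ i | refl = left i
... | inj₂ j | refl = right j

module _ (G H : Graph) where
  private
    module G = Graph G
    module H = Graph H
    module U = Graph (G ⊕ H)

  summandˡ : Component G (G ⊕ H)
  summandˡ = record
    { vertex           = _↑ˡ H.order
    ; edge             = _↑ˡ H.size
    ; ends-edge        = ends
    ; vertex-injective = ↑ˡ-injective H.order _ _
    ; edge-injective   = ↑ˡ-injective H.size _ _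
    ; incident-edge    = incident
    }
    where
    ends : ∀ e → U.ends (e ↑ˡ H.size) ≡ ×.map (_↑ˡ H.order) (_↑ˡ H.order) (G.ends e)
    ends e rewrite splitAt-↑ˡ G.size e H.size = refl

    incident : ∀ {u e} → (u ↑ˡ H.order) U.∈ᵉ e → ∃ λ e′ → e ≡ e′ ↑ˡ H.size
    incident {e = e} u∈e with split G.size e
    ... | left e′ = e′ , refl
    ... | right e′ rewrite splitAt-↑ʳ G.size H.size e′ = ⊥-elim ([ ↑ˡ≢↑ʳ , ↑ˡ≢↑ʳ ]′ u∈e)

  summandʳ : Component H (G ⊕ H)
  summandʳ = record
    { vertex           = G.order ↑ʳ_
    ; edge             = G.size ↑ʳ_
    ; ends-edge        = ends
    ; vertex-injective = ↑ʳ-injective G.order _ _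
    ; edge-injective   = ↑ʳ-injective G.size _ _
    ; incident-edge    = incident
    }
    where
    ends : ∀ e → U.ends (G.size ↑ʳ e) ≡ ×.map (G.order ↑ʳ_) (G.order ↑ʳ_) (H.ends e)
    ends e rewrite splitAt-↑ʳ G.size H.size e = refl

    incident : ∀ {u e} → (G.order ↑ʳ u) U.∈ᵉ e → ∃ λ e′ → e ≡ G.size ↑ʳ e′
    incident {e = e} u∈e with split G.size e
    ... | right e′ = e′ , refl
    ... | left e′ rewrite splitAt-↑ˡ G.size e′ H.size =
      ⊥-elim ([ ↑ˡ≢↑ʳ ∘ sym , ↑ˡ≢↑ʳ ∘ sym ]′ u∈e)

  data Summand : Element (G ⊕ H) → Set where
    inˡ : ∀ x → Summand (element summandˡ x)
    inʳ : ∀ y → Summand (element summandʳ y)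

  summand : ∀ x → Summand x
  summand (inj₁ u) with split G.order u
  ... | left a  = inˡ (inj₁ a)
  ... | right b = inʳ (inj₁ b)
  summand (inj₂ e) with split G.size e
  ... | left a  = inˡ (inj₂ a)
  ... | right b = inʳ (inj₂ b)

  -- Every condition involves an edge, and the summand containing that edge contains everything else
  -- the condition mentions. Splitting on one edge is therefore enough.
  proper-⊕ : ∀ {c} → Proper G (c ∘ element summandˡ) → Proper H (c ∘ element summandʳ) →
             Proper (G ⊕ H) c
  proper-⊕ {c} properG properH = record
    { vertices = λ (u≢v , e , u∈e , v∈e) → vertices e u≢v u∈e v∈e
    ; edges    = λ {e} (e≢e′ , u , u∈e , u∈e′) → edges e e≢e′ u∈e u∈e′
    ; incident = λ {_} {e} → incident e
    }
    where
    vertices : ∀ {u v} e → u ≢ v → u U.∈ᵉ e → v U.∈ᵉ e → c (inj₁ u) ≢ c (inj₁ v)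
    vertices e with split G.size e
    ... | left _  = Component.vertices-at summandˡ {c} properG
    ... | right _ = Component.vertices-at summandʳ {c} properH

    edges : ∀ {u} e {e′} → e ≢ e′ → u U.∈ᵉ e → u U.∈ᵉ e′ → c (inj₂ e) ≢ c (inj₂ e′)
    edges e with split G.size e
    ... | left _  = Component.edges-at summandˡ {c} properG
    ... | right _ = Component.edges-at summandʳ {c} properH

    incident : ∀ {u} e → u U.∈ᵉ e → c (inj₁ u) ≢ c (inj₂ e)
    incident e with split G.size e
    ... | left _  = Component.incident-at summandˡ {c} properG
    ... | right _ = Component.incident-at summandʳ {c} properH

  infixr 6 _⊹_

  _⊹_ : (Element G → ℕ) → (Element H → ℕ) → Element (G ⊕ H) → ℕ
  (g ⊹ h) (inj₁ u) = [ g ∘ inj₁ , h ∘ inj₁ ]′ (splitAt G.order u)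
  (g ⊹ h) (inj₂ e) = [ g ∘ inj₂ , h ∘ inj₂ ]′ (splitAt G.size e)

  ⊹-summandˡ : ∀ g h x → (g ⊹ h) (element summandˡ x) ≡ g x
  ⊹-summandˡ g h (inj₁ u) rewrite splitAt-↑ˡ G.order u H.order = refl
  ⊹-summandˡ g h (inj₂ e) rewrite splitAt-↑ˡ G.size e H.size = refl

  ⊹-summandʳ : ∀ g h y → (g ⊹ h) (element summandʳ y) ≡ h y
  ⊹-summandʳ g h (inj₁ u) rewrite splitAt-↑ʳ G.order H.order u = refl
  ⊹-summandʳ g h (inj₂ e) rewrite splitAt-↑ʳ G.size H.size e = refl

proper-≗ : ∀ {G c c′} → (∀ x → c x ≡ c′ x) → Proper G c′ → Proper G c
proper-≗ {G} {c} {c′} c≗c′ proper = record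
  { vertices = λ adj → Proper.vertices proper adj ∘ transport (inj₁ _) (inj₁ _)
  ; edges    = λ adj → Proper.edges proper adj ∘ transport (inj₂ _) (inj₂ _)
  ; incident = λ u∈e → Proper.incident proper u∈e ∘ transport (inj₁ _) (inj₂ _)
  }
  where
  transport : ∀ x y → c x ≡ c y → c′ x ≡ c′ y
  transport x y eq = trans (sym (c≗c′ x)) (trans eq (c≗c′ y))

proper-∘ : ∀ {G c} {h : ℕ → ℕ} → Injective _≡_ _≡_ h → Proper G c → Proper G (h ∘ c)
proper-∘ inj proper = record
  { vertices = λ adj → Proper.vertices proper adj ∘ inj
  ; edges    = λ adj → Proper.edges proper adj ∘ inj
  ; incident = λ u∈e → Proper.incident proper u∈e ∘ inj
  }

module _ {G H : Graph} {g : Element G → ℕ} {h : Element H → ℕ} where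

  weight-⊹ˡ : ∀ x → weight (G ⊕ H) (_⊹_ G H g h) (element (summandˡ G H) x) ≡ weight G g x
  weight-⊹ˡ = Component.weight-element (summandˡ G H) (⊹-summandˡ G H g h)

  weight-⊹ʳ : ∀ y → weight (G ⊕ H) (_⊹_ G H g h) (element (summandʳ G H) y) ≡ weight H h y
  weight-⊹ʳ = Component.weight-element (summandʳ G H) (⊹-summandʳ G H g h)

  ⊹-proper : Proper G (weight G g) → Proper H (weight H h) →
             Proper (G ⊕ H) (weight (G ⊕ H) (_⊹_ G H g h))
  ⊹-proper properG properH =
    proper-⊕ G H (proper-≗ weight-⊹ˡ properG) (proper-≗ weight-⊹ʳ properH)

  ⊹-injective : Injective _≡_ _≡_ g → Injective _≡_ _≡_ h → (∀ x y → g x ≢ h y) →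
                Injective _≡_ _≡_ (_⊹_ G H g h)
  ⊹-injective g-inj h-inj g≢h {x} {y} eq with summand G H x | summand G H y
  ... | inˡ a | inˡ b rewrite ⊹-summandˡ G H g h a | ⊹-summandˡ G H g h b =
    cong (element (summandˡ G H)) (g-inj eq)
  ... | inʳ a | inʳ b rewrite ⊹-summandʳ G H g h a | ⊹-summandʳ G H g h b =
    cong (element (summandʳ G H)) (h-inj eq)
  ... | inˡ a | inʳ b rewrite ⊹-summandˡ G H g h a | ⊹-summandʳ G H g h b = contradiction eq (g≢h a b)
  ... | inʳ a | inˡ b rewrite ⊹-summandʳ G H g h a | ⊹-summandˡ G H g h b =
    contradiction (sym eq) (g≢h b a)

-- Labels on repeated copies of one graph.

-- Each copy of G in k · G is labelled according to the number a of copies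
-- before it and the number b of copies after it, so that 1 + a + b = k.
module _ {G : Graph} (ℓ : ℕ → ℕ → Element G → ℕ) where

  copies : ∀ i k → Element (k · G) → ℕ
  copies i zero    = [ (λ ()) , (λ ()) ]′
  copies i (suc k) = _⊹_ G (k · G) (ℓ i k) (copies (suc i) k)

  -- The recursion preserves `i + k`, which is the total number of copies when it starts from 0. The
  -- bound `i ≤ a` is kept to tell a copy in the tail from the one at the head.
  copies-element : ∀ i k x → ∃₂ λ a b → i ≤ a × suc (a + b) ≡ i + k × ∃ λ y →
                   copies i k x ≡ ℓ a b y × weight (k · G) (copies i k) x ≡ weight G (ℓ a b) y
  copies-element i zero    (inj₁ ())
  copies-element i zero    (inj₂ ())
  copies-element i (suc k) x with summand G (k · G) x
  ... | inˡ y = i , k , ≤-refl , sym (+-suc i k) , y , ⊹-summandˡ G (k · G) _ _ y , weight-⊹ˡ y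
  ... | inʳ z with copies-element (suc i) k z
  ... | a , b , i<a , eq , y , label≡ , weight≡ =
    a , b , <⇒≤ i<a , trans eq (sym (+-suc i k)) , y ,
    trans (⊹-summandʳ G (k · G) _ _ z) label≡ , trans (weight-⊹ʳ {G} z) weight≡

  copies-proper : ∀ i k → (∀ a b → suc (a + b) ≡ i + k → Proper G (weight G (ℓ a b))) →
                  Proper (k · G) (weight (k · G) (copies i k))
  copies-proper i zero    _      = record
    { vertices = λ { (_ , () , _) } ; edges = λ { {()} } ; incident = λ { {_} {()} } }
  copies-proper i (suc k) proper = ⊹-proper (proper i k (sym (+-suc i k)))
    (copies-proper (suc i) k λ a b eq → proper a b (trans eq (sym (+-suc i k))))

  -- The label determines the index `a` of its copy. Copies in the tail have an index greater than
  -- `i`, so head and tail share no label.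
  copies-injective :
    ∀ i k → (∀ {a b a′ b′ x x′} → suc (a + b) ≡ i + k → suc (a′ + b′) ≡ i + k →
             ℓ a b x ≡ ℓ a′ b′ x′ → a ≡ a′ × x ≡ x′) →
    Injective _≡_ _≡_ (copies i k)
  copies-injective i zero    _   {inj₁ ()}
  copies-injective i zero    _   {inj₂ ()}
  copies-injective i (suc k) inj = ⊹-injective
    (proj₂ ∘ inj (sym (+-suc i k)) (sym (+-suc i k)))
    (copies-injective (suc i) k λ p q → inj (trans p (sym (+-suc i k))) (trans q (sym (+-suc i k))))
    apart
    where
    apart : ∀ x y → ℓ i k x ≢ copies (suc i) k y
    apart x y eq with copies-element (suc i) k y
    ... | a , b , i<a , total , z , label≡ , _ =
      <⇒≢ i<a (proj₁ (inj (sym (+-suc i k)) (trans total (sym (+-suc i k))) (trans eq label≡)))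

-- Sizes of repeated copies, and arithmetic of digits.

order-· : ∀ k G → Graph.order (k · G) ≡ k * Graph.order G
order-· zero    G = refl
order-· (suc k) G = cong (Graph.order G +_) (order-· k G)

size-· : ∀ k G → Graph.size (k · G) ≡ k * Graph.size G
size-· zero    G = refl
size-· (suc k) G = cong (Graph.size G +_) (size-· k G)

-- Labels that run downwards are indexed by the number `j` of copies that follow; this recovers `i`
-- from it.
complement-injective : ∀ {n i j i′ j′ : ℕ} → suc (i + j) ≡ n → suc (i′ + j′) ≡ n → j ≡ j′ → i ≡ i′
complement-injective {j = j} refl q refl = +-cancelʳ-≡ j _ _ (sym (suc-injective q))

-- Reducing modulo `d` isolates the digit, and cancelling it isolates the quotient.
digits-injective : ∀ d .{{_ : NonZero d}} {r r′ q q′} → r < d → r′ < d →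
                   r + q * d ≡ r′ + q′ * d → r ≡ r′ × q ≡ q′
digits-injective d {r} {r′} {q} {q′} r<d r′<d eq =
  r≡r′ , *-cancelʳ-≡ q q′ d (+-cancelˡ-≡ r _ _ (trans eq (cong (_+ q′ * d) (sym r≡r′))))
  where
  r≡r′ : r ≡ r′
  r≡r′ = begin
    r                  ≡⟨ m<n⇒m%n≡m r<d ⟨
    r % d              ≡⟨ [m+kn]%n≡m%n r q d ⟨
    (r + q * d) % d    ≡⟨ cong (_% d) eq ⟩
    (r′ + q′ * d) % d  ≡⟨ [m+kn]%n≡m%n r′ q′ d ⟩
    r′ % d             ≡⟨ m<n⇒m%n≡m r′<d ⟩
    r′                 ∎
    where open ≡-Reasoning

digits-< : ∀ {d r q Q} → r < d → q < Q → r + q * d < Q * d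
digits-< {d} {r} {q} r<d q<Q = <-≤-trans (+-monoˡ-< (q * d) r<d) (*-monoˡ-≤ d q<Q)

leftInverse⇒injective : ∀ {A B : Set} {f : A → B} (g : B → A) → (∀ x → g (f x) ≡ x) → Injective _≡_ _≡_ f
leftInverse⇒injective g inv {x} {y} eq = trans (sym (inv x)) (trans (cong g eq) (inv y))

-- Labels and weights of the hexagons.

-- A cycle takes its labels from two blocks of six consecutive numbers.  Each edge joins
-- a vertex of one block to a vertex of the other, and the edges at a vertex alternate too.
cycleSlot : Element (C 6) → Fin 6 ⊎ Fin 6
cycleSlot (inj₁ 0F) = inj₁ 1F
cycleSlot (inj₁ 1F) = inj₂ 3F
cycleSlot (inj₁ 2F) = inj₁ 2F
cycleSlot (inj₁ 3F) = inj₂ 4F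
cycleSlot (inj₁ 4F) = inj₁ 0F
cycleSlot (inj₁ 5F) = inj₂ 5F
cycleSlot (inj₂ 0F) = inj₁ 5F
cycleSlot (inj₂ 1F) = inj₂ 1F
cycleSlot (inj₂ 2F) = inj₁ 3F
cycleSlot (inj₂ 3F) = inj₂ 2F
cycleSlot (inj₂ 4F) = inj₁ 4F
cycleSlot (inj₂ 5F) = inj₂ 0F

-- An inverse table proves `cycleSlot` injective in twelve cases instead of one for each pair of
-- elements.
cycleElement : Fin 6 ⊎ Fin 6 → Element (C 6)
cycleElement (inj₁ 0F) = inj₁ 4F
cycleElement (inj₁ 1F) = inj₁ 0F
cycleElement (inj₁ 2F) = inj₁ 2F
cycleElement (inj₁ 3F) = inj₂ 2F
cycleElement (inj₁ 4F) = inj₂ 4F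
cycleElement (inj₁ 5F) = inj₂ 0F
cycleElement (inj₂ 0F) = inj₂ 5F
cycleElement (inj₂ 1F) = inj₂ 1F
cycleElement (inj₂ 2F) = inj₂ 3F
cycleElement (inj₂ 3F) = inj₁ 1F
cycleElement (inj₂ 4F) = inj₁ 3F
cycleElement (inj₂ 5F) = inj₁ 5F

cycleElement-cycleSlot : ∀ x → cycleElement (cycleSlot x) ≡ x
cycleElement-cycleSlot (inj₁ 0F) = refl
cycleElement-cycleSlot (inj₁ 1F) = refl
cycleElement-cycleSlot (inj₁ 2F) = refl
cycleElement-cycleSlot (inj₁ 3F) = refl
cycleElement-cycleSlot (inj₁ 4F) = refl
cycleElement-cycleSlot (inj₁ 5F) = refl
cycleElement-cycleSlot (inj₂ 0F) = refl
cycleElement-cycleSlot (inj₂ 1F) = refl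
cycleElement-cycleSlot (inj₂ 2F) = refl
cycleElement-cycleSlot (inj₂ 3F) = refl
cycleElement-cycleSlot (inj₂ 4F) = refl
cycleElement-cycleSlot (inj₂ 5F) = refl

-- The hexagon labels form 2m blocks of six. As i + j = m - 1, the blocks `i` and `m + j` are mirror
-- images: their indices add up to 2m - 1.
slotLabel : ℕ → ℕ → ℕ → Fin 6 ⊎ Fin 6 → ℕ
slotLabel m i j (inj₁ r) = toℕ r + i * 6
slotLabel m i j (inj₂ r) = toℕ r + (m + j) * 6

slotLabel-injective : ∀ {m i j i′ j′} → suc (i + j) ≡ m → suc (i′ + j′) ≡ m →
                      ∀ x x′ → slotLabel m i j x ≡ slotLabel m i′ j′ x′ → i ≡ i′ × x ≡ x′
slotLabel-injective {m} {i} {j} {i′} {j′} p q = λ where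
    (inj₁ r) (inj₁ r′) eq → let r≡r′ , i≡i′ = digits-injective 6 (toℕ<n r) (toℕ<n r′) eq in
      i≡i′ , cong inj₁ (toℕ-injective r≡r′)
    (inj₂ r) (inj₂ r′) eq → let r≡r′ , mj≡mj′ = digits-injective 6 (toℕ<n r) (toℕ<n r′) eq in
      complement-injective p q (+-cancelˡ-≡ m j j′ mj≡mj′) , cong inj₂ (toℕ-injective r≡r′)
    (inj₁ r) (inj₂ r′) eq →
      contradiction (proj₂ (digits-injective 6 {q = i} {m + j′} (toℕ<n r) (toℕ<n r′) eq))
                    (index≢ {b = j} p j′)
    (inj₂ r) (inj₁ r′) eq →
      contradiction (sym (proj₂ (digits-injective 6 {q = m + j} {i′} (toℕ<n r) (toℕ<n r′) eq)))
                    (index≢ {b = j′} q j)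
  where
  -- A lower block has index below `m`, an upper block has index at least `m`.
  index≢ : ∀ {a b} → suc (a + b) ≡ m → ∀ c → a ≢ m + c
  index≢ {a} {b} refl c = <⇒≢ (≤-trans (s≤s (m≤m+n a b)) (m≤m+n m c))

cycleLabel : (s m i j : ℕ) → Element (C 6) → ℕ
cycleLabel s m i j x = suc (s + slotLabel m i j (cycleSlot x))

-- In the cyclic order v0, e0, v1, e1, ... the colours repeat 1, 0, 2. Elements required to differ
-- are at distance at most 2 in that order. Colour `c` stands for the offset of a weight from the
-- least of the three.
cycleColour : Element (C 6) → Fin 3
cycleColour (inj₁ 0F) = 1F
cycleColour (inj₁ 1F) = 2F
cycleColour (inj₁ 2F) = 0F
cycleColour (inj₁ 3F) = 1F
cycleColour (inj₁ 4F) = 2F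
cycleColour (inj₁ 5F) = 0F
cycleColour (inj₂ 0F) = 0F
cycleColour (inj₂ 1F) = 1F
cycleColour (inj₂ 2F) = 2F
cycleColour (inj₂ 3F) = 0F
cycleColour (inj₂ 4F) = 1F
cycleColour (inj₂ 5F) = 2F

cycleColour-proper : Proper (C 6) (toℕ ∘ cycleColour)
cycleColour-proper = record
  { vertices = λ {u} {v} (u≢v , e , u∈e , v∈e) → vertices e u v u≢v u∈e v∈e
  ; edges    = λ {e} {e′} (e≢e′ , u , u∈e , u∈e′) → edges e e′ u e≢e′ u∈e u∈e′
  ; incident = λ {u} {e} → incident e u
  }
  where
  open Graph (C 6)
  c : Element (C 6) → ℕ
  c = toℕ ∘ cycleColour
  vertices : ∀ e u v → u ≢ v → u ∈ᵉ e → v ∈ᵉ e → c (inj₁ u) ≢ c (inj₁ v)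
  vertices = from-yes (all? λ e → all? λ u → all? λ v → ¬? (u Finₚ.≟ v) →-dec (u ∈ᵉ? e) →-dec
               (v ∈ᵉ? e) →-dec ¬? (c (inj₁ u) ℕ.≟ c (inj₁ v)))
  edges : ∀ e e′ u → e ≢ e′ → u ∈ᵉ e → u ∈ᵉ e′ → c (inj₂ e) ≢ c (inj₂ e′)
  edges = from-yes (all? λ e → all? λ e′ → all? λ u → ¬? (e Finₚ.≟ e′) →-dec (u ∈ᵉ? e) →-dec
            (u ∈ᵉ? e′) →-dec ¬? (c (inj₂ e) ℕ.≟ c (inj₂ e′)))
  incident : ∀ e u → u ∈ᵉ e → c (inj₁ u) ≢ c (inj₂ e)
  incident = from-yes (all? λ e → all? λ u → (u ∈ᵉ? e) →-dec ¬? (c (inj₁ u) ℕ.≟ c (inj₂ e)))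

module _ (s : ℕ) where

  cycleWeight : ℕ → Fin 3 → ℕ
  cycleWeight m c = s + s + (m + m) * 6 + toℕ c

  -- `a` and `b` are offsets in the lower and the upper block. The block indices add up to 2m - 1,
  -- contributing 12m - 6, and the start of the labels at 1 contributes 2; hence the 4.
  slots-sum : ∀ i j a b c → a + b ≡ 4 + c →
              suc (s + (a + i * 6)) + suc (s + (b + (suc (i + j) + j) * 6)) ≡
              s + s + (suc (i + j) + suc (i + j)) * 6 + c
  slots-sum i j a b c a+b≡4+c = begin
    suc (s + (a + i * 6)) + suc (s + (b + (suc (i + j) + j) * 6))  ≡⟨ regroup s i j a b ⟩
    s + s + (8 + 12 * i + 12 * j + (a + b))
      ≡⟨ cong (λ t → s + s + (8 + 12 * i + 12 * j + t)) a+b≡4+c ⟩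
    s + s + (8 + 12 * i + 12 * j + (4 + c))                        ≡⟨ collect s i j c ⟩
    s + s + (suc (i + j) + suc (i + j)) * 6 + c                    ∎
    where
    open ≡-Reasoning
    regroup : ∀ s i j a b → suc (s + (a + i * 6)) + suc (s + (b + (suc (i + j) + j) * 6)) ≡
                            s + s + (8 + 12 * i + 12 * j + (a + b))
    regroup = solve-∀
    collect : ∀ s i j c → s + s + (8 + 12 * i + 12 * j + (4 + c)) ≡
                          s + s + (suc (i + j) + suc (i + j)) * 6 + c
    collect = solve-∀

  slots-sumᶜ : ∀ i j b a c → a + b ≡ 4 + c →
               suc (s + (b + (suc (i + j) + j) * 6)) + suc (s + (a + i * 6)) ≡
               s + s + (suc (i + j) + suc (i + j)) * 6 + c
  slots-sumᶜ i j b a c eq =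
    trans (+-comm (suc (s + (b + (suc (i + j) + j) * 6))) _) (slots-sum i j a b c eq)

  cycle-weight : ∀ {m i j} → suc (i + j) ≡ m → ∀ x →
                 weight (C 6) (cycleLabel s m i j) x ≡ cycleWeight m (cycleColour x)
  cycle-weight {i = i} {j} refl x = go x
    where
    ℓ : Fin 6 → ℕ
    ℓ e = cycleLabel s (suc (i + j)) i j (inj₂ e)

    -- The `sum` over the two edges at a vertex leaves a trailing `+ 0`.
    edge-pair : ∀ e e′ {w} → ℓ e + ℓ e′ ≡ w → ℓ e + (ℓ e′ + 0) ≡ w
    edge-pair e e′ = trans (cong (ℓ e +_) (+-identityʳ (ℓ e′)))

    go : ∀ x → weight (C 6) (cycleLabel s (suc (i + j)) i j) x ≡
               cycleWeight (suc (i + j)) (cycleColour x)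
    -- Each row reads off two offsets from `cycleSlot`; `slots-sumᶜ` serves where the upper label
    -- comes first in the sum.
    go (inj₁ 0F) = edge-pair 0F 5F (slots-sum i j 5 0 1 refl)
    go (inj₁ 1F) = edge-pair 0F 1F (slots-sum i j 5 1 2 refl)
    go (inj₁ 2F) = edge-pair 1F 2F (slots-sumᶜ i j 1 3 0 refl)
    go (inj₁ 3F) = edge-pair 2F 3F (slots-sum i j 3 2 1 refl)
    go (inj₁ 4F) = edge-pair 3F 4F (slots-sumᶜ i j 2 4 2 refl)
    go (inj₁ 5F) = edge-pair 4F 5F (slots-sum i j 4 0 0 refl)
    go (inj₂ 0F) = slots-sum i j 1 3 0 refl
    go (inj₂ 1F) = slots-sumᶜ i j 3 2 1 refl
    go (inj₂ 2F) = slots-sum i j 2 4 2 refl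
    go (inj₂ 3F) = slots-sumᶜ i j 4 0 0 refl
    go (inj₂ 4F) = slots-sum i j 0 5 1 refl
    go (inj₂ 5F) = slots-sumᶜ i j 5 1 2 refl

  cycleLabel-proper : ∀ {m i j} → suc (i + j) ≡ m →
                      Proper (C 6) (weight (C 6) (cycleLabel s m i j))
  cycleLabel-proper {m} eq = proper-≗ (cycle-weight eq)
    (proper-∘ {h = λ t → s + s + (m + m) * 6 + t} (+-cancelˡ-≡ (s + s + (m + m) * 6) _ _)
              cycleColour-proper)

  cycleLabel-injective : ∀ {m a b a′ b′ x x′} → suc (a + b) ≡ m → suc (a′ + b′) ≡ m →
                         cycleLabel s m a b x ≡ cycleLabel s m a′ b′ x′ → a ≡ a′ × x ≡ x′
  cycleLabel-injective {m} {x = x} {x′} p q eq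
    with slotLabel-injective {m} p q (cycleSlot x) (cycleSlot x′)
           (+-cancelˡ-≡ s _ _ (suc-injective eq))
  ... | a≡a′ , slot≡ = a≡a′ , leftInverse⇒injective cycleElement cycleElement-cycleSlot slot≡

  cycleLabel-≤ : ∀ {m i j} → suc (i + j) ≡ m → ∀ x → cycleLabel s m i j x ≤ s + (m + m) * 6
  cycleLabel-≤ {m} {i} {j} refl x =
    subst (_≤ s + (m + m) * 6) (+-suc s _) (+-monoʳ-≤ s (bound (cycleSlot x)))
    where
    bound : ∀ y → slotLabel m i j y < (m + m) * 6
    bound (inj₁ r) = digits-< (toℕ<n r) (≤-trans (m≤m+n (suc i) j) (m≤m+n m m))
    bound (inj₂ r) = digits-< (toℕ<n r) (+-monoʳ-< m (s≤s (m≤n+m j i)))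

-- Labels and weights of the paths.

-- The leaves of the paths take the smallest labels; the centres, the edges inj₂ 1F and the
-- edges inj₂ 0F take the three blocks of n labels above those of the cycles.
pathSlot : Element (P 3) → Fin 2 ⊎ Fin 3
pathSlot (inj₁ 0F) = inj₁ 0F
pathSlot (inj₁ 1F) = inj₂ 0F
pathSlot (inj₁ 2F) = inj₁ 1F
pathSlot (inj₂ 0F) = inj₂ 2F
pathSlot (inj₂ 1F) = inj₂ 1F

pathElement : Fin 2 ⊎ Fin 3 → Element (P 3)
pathElement (inj₁ 0F) = inj₁ 0F
pathElement (inj₁ 1F) = inj₁ 2F
pathElement (inj₂ 0F) = inj₁ 1F
pathElement (inj₂ 1F) = inj₂ 1F
pathElement (inj₂ 2F) = inj₂ 0F

pathElement-pathSlot : ∀ x → pathElement (pathSlot x) ≡ x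
pathElement-pathSlot (inj₁ 0F) = refl
pathElement-pathSlot (inj₁ 1F) = refl
pathElement-pathSlot (inj₁ 2F) = refl
pathElement-pathSlot (inj₂ 0F) = refl
pathElement-pathSlot (inj₂ 1F) = refl

-- As `i` grows by one, the labels of the centre and of the edge `0F` drop by one and that of the
-- edge `1F` rises by one, so the sum of the two edge labels is constant. The leaf labels rise by
-- two, so each edge weight rises by one.
pathIndex : ℕ → ℕ → Fin 3 → ℕ
pathIndex i j 0F = j
pathIndex i j 1F = i
pathIndex i j 2F = j

pathIndex-< : ∀ {n i j} → suc (i + j) ≡ n → ∀ r → pathIndex i j r < n
pathIndex-< {i = i} {j} refl 0F = s≤s (m≤n+m j i)
pathIndex-< {i = i} {j} refl 1F = s≤s (m≤m+n i j)
pathIndex-< {i = i} {j} refl 2F = s≤s (m≤n+m j i)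

pathIndex-injective : ∀ {n i j i′ j′} → suc (i + j) ≡ n → suc (i′ + j′) ≡ n →
                      ∀ r → pathIndex i j r ≡ pathIndex i′ j′ r → i ≡ i′
pathIndex-injective p q 0F = complement-injective p q
pathIndex-injective p q 1F = id
pathIndex-injective p q 2F = complement-injective p q

module _ (M : ℕ) where

  -- The 2n leaf slots come first, then a gap of `M` slots left to the hexagons. The 2 in
  -- `2 + toℕ r` accounts for the two blocks of `n` slots taken by the leaves.
  pathSlotLabel : (n i j : ℕ) → Fin 2 ⊎ Fin 3 → ℕ
  pathSlotLabel n i j (inj₁ r) = toℕ r + i * 2
  pathSlotLabel n i j (inj₂ r) = M + (pathIndex i j r + (2 + toℕ r) * n)

  pathLabel : (n i j : ℕ) → Element (P 3) → ℕ
  pathLabel n i j x = suc (pathSlotLabel n i j (pathSlot x))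

  leafSlot-< : ∀ {n i j} → suc (i + j) ≡ n → ∀ r → pathSlotLabel n i j (inj₁ r) < n * 2
  leafSlot-< {i = i} {j} refl r = digits-< (toℕ<n r) (s≤s (m≤m+n i j))

  ≤-stemSlot : ∀ {n} i j r → M + n * 2 ≤ pathSlotLabel n i j (inj₂ r)
  ≤-stemSlot {n} i j r = +-monoʳ-≤ M (begin
    n * 2                                ≡⟨ *-comm n 2 ⟩
    2 * n                                ≤⟨ *-monoˡ-≤ n (m≤m+n 2 (toℕ r)) ⟩
    (2 + toℕ r) * n                      ≤⟨ m≤n+m _ (pathIndex i j r) ⟩
    pathIndex i j r + (2 + toℕ r) * n    ∎)
    where open ≤-Reasoning

  leafSlot≢stemSlot : ∀ {n i j i′ j′} → suc (i + j) ≡ n → ∀ r r′ →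
                      pathSlotLabel n i j (inj₁ r) ≢ pathSlotLabel n i′ j′ (inj₂ r′)
  leafSlot≢stemSlot {n} {i} {j} {i′} {j′} p r r′ =
    <⇒≢ (<-≤-trans (leafSlot-< {n} {i} {j} p r) (≤-trans (m≤n+m (n * 2) M) (≤-stemSlot {n} i′ j′ r′)))

  pathSlotLabel-injective : ∀ {n i j i′ j′} → suc (i + j) ≡ n → suc (i′ + j′) ≡ n → ∀ y y′ →
                            pathSlotLabel n i j y ≡ pathSlotLabel n i′ j′ y′ → i ≡ i′ × y ≡ y′
  pathSlotLabel-injective p q (inj₁ r) (inj₁ r′) eq with digits-injective 2 (toℕ<n r) (toℕ<n r′) eq
  ... | r≡r′ , i≡i′ = i≡i′ , cong inj₁ (toℕ-injective r≡r′)
  -- Matching `n` as a successor provides the `NonZero` instance for digits to base `n`.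
  pathSlotLabel-injective {n@(suc _)} {i} {j} {i′} {j′} p q (inj₂ r) (inj₂ r′) eq
    with digits-injective n (pathIndex-< p r) (pathIndex-< q r′) (+-cancelˡ-≡ M _ _ eq)
  ... | index≡ , r≡r′ with toℕ-injective {i = r} {r′} (+-cancelˡ-≡ 2 _ _ r≡r′)
  ... | refl = pathIndex-injective p q r index≡ , refl
  pathSlotLabel-injective {n} {i} {j} {i′} {j′} p q (inj₁ r) (inj₂ r′) eq =
    contradiction eq (leafSlot≢stemSlot {n} {i} {j} {i′} {j′} p r r′)
  pathSlotLabel-injective {n} {i} {j} {i′} {j′} p q (inj₂ r) (inj₁ r′) eq =
    contradiction (sym eq) (leafSlot≢stemSlot {n} {i′} {j′} {i} {j} q r′ r)

  pathLabel-injective : ∀ {n a b a′ b′ x x′} → suc (a + b) ≡ n → suc (a′ + b′) ≡ n →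
                        pathLabel n a b x ≡ pathLabel n a′ b′ x′ → a ≡ a′ × x ≡ x′
  pathLabel-injective {n} {a} {b} {a′} {b′} {x} {x′} p q eq
    with pathSlotLabel-injective {i = a} {b} {a′} {b′} p q (pathSlot x) (pathSlot x′) (suc-injective eq)
  ... | a≡a′ , slot≡ = a≡a′ , leftInverse⇒injective pathElement pathElement-pathSlot slot≡

  pathLabel-≤ : ∀ {n i j} → suc (i + j) ≡ n → ∀ x → pathLabel n i j x ≤ M + 5 * n
  pathLabel-≤ {n} {i} {j} p x = bound (pathSlot x)
    where
    bound : ∀ y → pathSlotLabel n i j y < M + 5 * n
    bound (inj₁ r) = <-≤-trans (leafSlot-< {n} {i} {j} p r) (begin
      n * 2      ≡⟨ *-comm n 2 ⟩
      2 * n      ≤⟨ *-monoˡ-≤ n (m≤m+n 2 3) ⟩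
      5 * n      ≤⟨ m≤n+m (5 * n) M ⟩
      M + 5 * n  ∎)
      where open ≤-Reasoning
    bound (inj₂ r) = +-monoʳ-< M (digits-< (pathIndex-< p r) (+-monoʳ-< 2 (toℕ<n r)))

  -- The range of `t` is the gap between the leaf labels and the other path labels, where the
  -- hexagons take theirs.
  pathLabel-avoids : ∀ {n i j} → suc (i + j) ≡ n → ∀ x {t} → n * 2 < t → t ≤ n * 2 + M →
                     t ≢ pathLabel n i j x
  pathLabel-avoids {n} {i} {j} p x {t} lo hi eq = apart (pathSlot x) eq
    where
    apart : ∀ y → t ≢ suc (pathSlotLabel n i j y)
    apart (inj₁ r) = <⇒≢ (≤-<-trans (leafSlot-< {n} {i} {j} p r) lo) ∘ sym
    apart (inj₂ r) =
      <⇒≢ (s≤s (≤-trans hi (≤-trans (≤-reflexive (+-comm (n * 2) M)) (≤-stemSlot {n} i j r))))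

  pathBase : ℕ → ℕ
  pathBase n = suc (M + 3 * n)

  -- With B for `pathBase n`, the edge labels are B + 2n - 1 - i and B + i, whose sum does not
  -- depend on `i`.
  centreWeight : ℕ → ℕ
  centreWeight n = pathBase n + pathBase n + (n + ℕ.pred n)

  -- Apart from the centre, every weight is `pathBase n + t` with t < 2n: leaves `2F` fill the lower
  -- half of this range, leaves `0F` the upper half, and the edges fall on values among these.
  pathWeight : (n i j : ℕ) → Element (P 3) → ℕ
  pathWeight n i j (inj₁ 0F) = pathBase n + (n + j)
  pathWeight n i j (inj₁ 1F) = centreWeight n
  pathWeight n i j (inj₁ 2F) = pathBase n + i
  pathWeight n i j (inj₂ 0F) = pathBase n + i
  pathWeight n i j (inj₂ 1F) = pathBase n + suc i

  path-weight : ∀ {n i j} → suc (i + j) ≡ n → ∀ x →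
                weight (P 3) (pathLabel n i j) x ≡ pathWeight n i j x
  path-weight {i = i} {j} refl (inj₁ 0F) = calc M i j
    where
    calc : ∀ M i j → suc (M + (j + 4 * suc (i + j))) + 0 ≡ suc (M + 3 * suc (i + j)) + (suc (i + j) + j)
    calc = solve-∀
  path-weight {i = i} {j} refl (inj₁ 1F) = calc M i j
    where
    calc : ∀ M i j → suc (M + (j + 4 * suc (i + j))) + (suc (M + (i + 3 * suc (i + j))) + 0) ≡
                     suc (M + 3 * suc (i + j)) + suc (M + 3 * suc (i + j)) + (suc (i + j) + (i + j))
    calc = solve-∀
  path-weight {i = i} {j} refl (inj₁ 2F) = calc M i j
    where
    calc : ∀ M i j → suc (M + (i + 3 * suc (i + j))) + 0 ≡ suc (M + 3 * suc (i + j)) + i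
    calc = solve-∀
  path-weight {i = i} {j} refl (inj₂ 0F) = calc M i j
    where
    calc : ∀ M i j → suc (0 + i * 2) + suc (M + (j + 2 * suc (i + j))) ≡ suc (M + 3 * suc (i + j)) + i
    calc = solve-∀
  path-weight {i = i} {j} refl (inj₂ 1F) = calc M i j
    where
    calc : ∀ M i j → suc (M + (j + 2 * suc (i + j))) + suc (1 + i * 2) ≡
                     suc (M + 3 * suc (i + j)) + suc i
    calc = solve-∀

  <-centreWeight : ∀ n t → t < n + n → pathBase n + t < centreWeight n
  <-centreWeight n t t<2n = begin-strict
    B + t                       ≤⟨ +-monoʳ-≤ B (≤-pred (<-≤-trans t<2n (≤-reflexive (lemma n t t<2n)))) ⟩
    B + (n + ℕ.pred n)          <⟨ +-monoˡ-< (n + ℕ.pred n) (m<m+n B (s≤s z≤n)) ⟩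
    B + B + (n + ℕ.pred n)      ∎
    where
    open ≤-Reasoning
    B = pathBase n
    -- The inequality excludes `n = 0`, where `pred` would truncate.
    lemma : ∀ n t → t < n + n → n + n ≡ suc (n + ℕ.pred n)
    lemma (suc n) t _ = +-suc (suc n) n

  pathWeight-proper : ∀ {n i j} → suc (i + j) ≡ n → Proper (P 3) (pathWeight n i j)
  pathWeight-proper {n} {i} {j} p = record
    { vertices = λ (u≢v , e , u∈e , v∈e) → vertices e u≢v u∈e v∈e
    ; edges    = λ {e} {e′} (e≢e′ , _) → edges e e′ e≢e′
    ; incident = λ {_} {e} → incident e
    }
    where
    open Graph (P 3)
    w = pathWeight n i j

    i<n : i < n
    i<n = pathIndex-< {j = j} p 1F

    0≢1 : w (inj₁ 0F) ≢ w (inj₁ 1F)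
    0≢1 = <⇒≢ (<-centreWeight n (n + j) (+-monoʳ-< n (pathIndex-< {i = i} p 0F)))

    2≢1 : w (inj₁ 2F) ≢ w (inj₁ 1F)
    2≢1 = <⇒≢ (<-centreWeight n i (<-≤-trans i<n (m≤m+n n n)))

    vertices : ∀ {u v} e → u ≢ v → u ∈ᵉ e → v ∈ᵉ e → w (inj₁ u) ≢ w (inj₁ v)
    vertices e u≢v (inj₁ refl) (inj₁ refl) = contradiction refl u≢v
    vertices e u≢v (inj₂ refl) (inj₂ refl) = contradiction refl u≢v
    vertices 0F _ (inj₁ refl) (inj₂ refl) = 0≢1
    vertices 0F _ (inj₂ refl) (inj₁ refl) = 0≢1 ∘ sym
    vertices 1F _ (inj₁ refl) (inj₂ refl) = 2≢1 ∘ sym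
    vertices 1F _ (inj₂ refl) (inj₁ refl) = 2≢1

    edges : ∀ e e′ → e ≢ e′ → w (inj₂ e) ≢ w (inj₂ e′)
    edges 0F 0F e≢e = contradiction refl e≢e
    edges 0F 1F _   = 1+n≢n ∘ sym ∘ +-cancelˡ-≡ (pathBase n) _ _
    edges 1F 0F _   = 1+n≢n ∘ +-cancelˡ-≡ (pathBase n) _ _
    edges 1F 1F e≢e = contradiction refl e≢e

    incident : ∀ {u} e → u ∈ᵉ e → w (inj₁ u) ≢ w (inj₂ e)
    incident 0F (inj₁ refl) = <⇒≢ (<-≤-trans i<n (m≤m+n n j)) ∘ sym ∘ +-cancelˡ-≡ (pathBase n) _ _
    incident 0F (inj₂ refl) = 2≢1 ∘ sym
    incident 1F (inj₁ refl) =
      <⇒≢ (<-centreWeight n (suc i) (+-mono-≤-< (≤-trans (s≤s z≤n) i<n) i<n)) ∘ sym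
    incident 1F (inj₂ refl) = 1+n≢n ∘ sym ∘ +-cancelˡ-≡ (pathBase n) _ _

  pathLabel-proper : ∀ {n i j} → suc (i + j) ≡ n → Proper (P 3) (weight (P 3) (pathLabel n i j))
  pathLabel-proper p = proper-≗ (path-weight p) (pathWeight-proper p)

-- From injective labels to labelings, and bounds on the number of weights.

module _ {G : Graph} {g : Element G → ℕ} where
  open Graph G

  -- An injection of the p + q elements into p + q labels is a bijection. Taking `pred` shifts the
  -- labels 1, ..., p + q to the indices in `Fin`.
  toLabeling : Injective _≡_ _≡_ g → (∀ x → 0 < g x × g x ≤ order + size) →
               Σ (Labeling G) λ f → ∀ x → label G f x ≡ g x
  toLabeling inj bounds = mk⤖ (to-injective , to-surjective) , label-to
    where
    pred< : ∀ {t N} → 0 < t × t ≤ N → ℕ.pred t < N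
    pred< {suc _} (_ , t≤N) = t≤N

    suc-pred′ : ∀ {t} → 0 < t → suc (ℕ.pred t) ≡ t
    suc-pred′ {suc _} _ = refl

    to : Element G → Fin (order + size)
    to x = fromℕ< (pred< (bounds x))

    label-to : ∀ x → suc (toℕ (to x)) ≡ g x
    label-to x = trans (cong suc (toℕ-fromℕ< (pred< (bounds x)))) (suc-pred′ (proj₁ (bounds x)))

    to-injective : Injective _≡_ _≡_ to
    to-injective {x} {y} eq = inj (trans (sym (label-to x)) (trans (cong (suc ∘ toℕ) eq) (label-to y)))

    splitAt-injective : Injective _≡_ _≡_ (splitAt order {size})
    splitAt-injective = leftInverse⇒injective (Fin.join order size) (join-splitAt order size)

    to-surjective : Surjective _≡_ _≡_ to
    -- Composing with `splitAt` turns `to` into a self-map of `Fin (order + size)`, to which the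
    -- counting argument applies.
    to-surjective y with injective⇒surjective (splitAt-injective ∘ to-injective) y
    ... | k , eq = splitAt order k , λ { refl → eq }

module _ {G : Graph} (f : Labeling G) where
  open Graph G

  label-positive : ∀ x → 0 < label G f x
  label-positive x = s≤s z≤n

  label-injective : Injective _≡_ _≡_ (label G f)
  label-injective = Bijection.injective f ∘ toℕ-injective ∘ suc-injective

  proper⇒antimagic : Proper G (weight G (label G f)) → IsLocalTotalAntimagic G f
  proper⇒antimagic proper = record
    { vertices-distinct = Proper.vertices proper
    ; edges-distinct    = Proper.edges proper
    ; incident-distinct = Proper.incident proper
    }

  antimagic⇒proper : IsLocalTotalAntimagic G f → Proper G (weight G (label G f))
  antimagic⇒proper lta = record
    { vertices = IsLocalTotalAntimagic.vertices-distinct lta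
    ; edges    = IsLocalTotalAntimagic.edges-distinct lta
    ; incident = IsLocalTotalAntimagic.incident-distinct lta
    }

  weight∈weights : ∀ x → weight G (label G f) x ∈ weights G f
  weight∈weights (inj₁ u) = ∈-++⁺ˡ (∈-map⁺ (vertexWeight G f) (∈-allFin u))
  weight∈weights (inj₂ e) = ∈-++⁺ʳ (map (vertexWeight G f) (allFin order))
                                   (∈-map⁺ (edgeWeight G f) (∈-allFin e))

  weights⁻ : ∀ {w} → w ∈ weights G f → ∃ λ x → w ≡ weight G (label G f) x
  weights⁻ w∈ with ∈-++⁻ (map (vertexWeight G f) (allFin order)) w∈
  ... | inj₁ w∈v with ∈-map⁻ (vertexWeight G f) w∈v
  ... | u , _ , eq = inj₁ u , eq
  weights⁻ w∈ | inj₂ w∈e with ∈-map⁻ (edgeWeight G f) w∈e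
  ... | e , _ , eq = inj₂ e , eq

  numberOfWeights-≤ : ∀ {ys} → (∀ x → weight G (label G f) x ∈ ys) → numberOfWeights G f ≤ length ys
  numberOfWeights-≤ {ys} weights∈ys = unique-⊆⇒length-≤ (DecUnique.deduplicate-! ℕ._≟_ (weights G f)) sub
    where
    sub : deduplicate ℕ._≟_ (weights G f) ⊆ ys
    sub w∈ with weights⁻ (∈-deduplicate⁻ ℕ._≟_ (weights G f) w∈)
    ... | x , refl = weights∈ys x

  ≤-numberOfWeights : ∀ {xs} → Unique xs → (∀ {w} → w ∈ xs → ∃ λ x → weight G (label G f) x ≡ w) →
                      length xs ≤ numberOfWeights G f
  ≤-numberOfWeights {xs} uxs xs-weights = unique-⊆⇒length-≤ uxs sub
    where
    sub : xs ⊆ deduplicate ℕ._≟_ (weights G f)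
    sub w∈ with xs-weights w∈
    ... | x , refl = ∈-deduplicate⁺ ℕ._≟_ (weight∈weights x)

-- The lower bound, applied to the exhibited labeling itself, turns its upper bound into an
-- equality.
χₗₜ-intro : ∀ {G k} →
            (Σ (Labeling G) λ f → IsLocalTotalAntimagic G f × numberOfWeights G f ≤ k) →
            (∀ f → IsLocalTotalAntimagic G f → k ≤ numberOfWeights G f) → χₗₜ G ≔ k
χₗₜ-intro (f , lta , ≤k) k≤ = (f , lta , ≤-antisym ≤k (k≤ f lta)) , λ { (f′ , lta′ , refl) → k≤ f′ lta′ }

-- Upper bounds: one labeling of hexagons and paths together.

-- An interface shared by `P 3` and `n · P 3`, since `1 · P 3` unfolds to `P 3 ⊕ P 0` and not to
-- `P 3`.
record PathFamily (M n : ℕ) (H : Graph) : Set where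
  field
    order-≡         : Graph.order H ≡ n * 3
    size-≡          : Graph.size H ≡ n * 2
    labels          : Element H → ℕ
    labels-injective : Injective _≡_ _≡_ labels
    labels-proper    : Proper H (weight H labels)
    labels-element   : ∀ y → ∃₂ λ a b → suc (a + b) ≡ n × ∃ λ x →
                      labels y ≡ pathLabel M n a b x ×
                       weight H labels y ≡ weight (P 3) (pathLabel M n a b) x

singlePath : ∀ M → PathFamily M 1 (P 3)
singlePath M = record
  { order-≡         = refl
  ; size-≡          = refl
  ; labels          = pathLabel M 1 0 0
  ; labels-injective = λ {x} {y} eq →
      proj₂ (pathLabel-injective M {1} {0} {0} {0} {0} {x} {y} refl refl eq)
  ; labels-proper    = pathLabel-proper M {1} {0} {0} refl
  ; labels-element   = λ x → 0 , 0 , refl , x , refl , refl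
  }

manyPaths : ∀ M n → PathFamily M n (n · P 3)
manyPaths M n = record
  { order-≡         = order-· n (P 3)
  ; size-≡          = size-· n (P 3)
  ; labels          = copies (pathLabel M n) 0 n
  ; labels-injective = copies-injective (pathLabel M n) 0 n (pathLabel-injective M)
  ; labels-proper    = copies-proper (pathLabel M n) 0 n λ a b → pathLabel-proper M {n} {a} {b}
  ; labels-element   = λ y → let a , b , _ , rest = copies-element (pathLabel M n) 0 n y in a , b , rest
  }

module _ (m : ℕ) {n : ℕ} {H : Graph} (paths : PathFamily ((m + m) * 6) n H) where
  private
    module H = PathFamily paths
    M = (m + m) * 6
    -- The hexagon labels start after those of the 2n leaves.
    s = n * 2
    U = m · C 6 ⊕ H

    ℓ : Element (m · C 6) → ℕ
    ℓ = copies (cycleLabel s m) 0 m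

    g : Element U → ℕ
    g = _⊹_ (m · C 6) H ℓ H.labels

    total : Graph.order U + Graph.size U ≡ M + 5 * n
    total = trans (cong₂ _+_ (cong₂ _+_ (order-· m (C 6)) H.order-≡)
                             (cong₂ _+_ (size-· m (C 6)) H.size-≡))
                  (calc m n)
      where
      calc : ∀ m n → m * 6 + n * 3 + (m * 6 + n * 2) ≡ (m + m) * 6 + 5 * n
      calc = solve-∀

    ℓ-bounds : ∀ x → s < ℓ x × ℓ x ≤ s + M
    ℓ-bounds x with copies-element (cycleLabel s m) 0 m x
    ... | a , b , _ , eq , y , label≡ , _ rewrite label≡ =
      s≤s (m≤m+n s _) , cycleLabel-≤ s eq y

    g-injective : Injective _≡_ _≡_ g
    g-injective = ⊹-injective (copies-injective (cycleLabel s m) 0 m (cycleLabel-injective s))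
                              H.labels-injective apart
      where
      apart : ∀ x y → ℓ x ≢ H.labels y
      apart x y eq with H.labels-element y
      ... | a , b , a+b , z , label≡ , _ = pathLabel-avoids M {n} {a} {b} a+b z
        (proj₁ (ℓ-bounds x)) (proj₂ (ℓ-bounds x)) (trans eq label≡)

    g-bounds : ∀ x → 0 < g x × g x ≤ Graph.order U + Graph.size U
    g-bounds x rewrite total with summand (m · C 6) H x
    ... | inˡ y rewrite ⊹-summandˡ (m · C 6) H ℓ H.labels y =
      ≤-<-trans z≤n (proj₁ (ℓ-bounds y)) , ≤-trans (proj₂ (ℓ-bounds y)) (begin
        n * 2 + M  ≡⟨ trans (+-comm (n * 2) M) (cong (M +_) (*-comm n 2)) ⟩
        M + 2 * n  ≤⟨ +-monoʳ-≤ M (*-monoˡ-≤ n (m≤m+n 2 3)) ⟩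
        M + 5 * n  ∎)
      where open ≤-Reasoning
    ... | inʳ y rewrite ⊹-summandʳ (m · C 6) H ℓ H.labels y with H.labels-element y
    ... | a , b , eq , z , label≡ , _ rewrite label≡ = s≤s z≤n , pathLabel-≤ M {n} {a} {b} eq z

    g-proper : Proper U (weight U g)
    g-proper = ⊹-proper (copies-proper (cycleLabel s m) 0 m λ a b → cycleLabel-proper s {m} {a} {b})
                        H.labels-proper

  -- The edge and leaf weights of the paths fill an interval of 2n numbers, and the three
  -- cycle weights are the n-th, (n+1)-st and (n+2)-nd numbers from its start; only for n = 1
  -- does the last of these fall outside the interval.
  palette : ℕ → List ℕ
  palette k = centreWeight M n ∷ map (pathBase M n +_) (upTo k)

  -- The first bound makes room for the leaf weights, the second for the hexagon weights, whose
  -- offsets from `pathBase M n` reach n + 1.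
  module _ {k : ℕ} (2n≤k : n + n ≤ k) (n+1<k : suc n < k) where
    private
      ∈-palette : ∀ {w} t → t < k → w ≡ pathBase M n + t → w ∈ palette k
      ∈-palette t t<k refl = there (∈-map⁺ (pathBase M n +_) (∈-upTo⁺ t<k))

      cycleWeight∈ : ∀ {n} → suc n < k → 0 < n → ∀ c →
                     ∃ λ t → t < k × cycleWeight (n * 2) m c ≡ pathBase M n + t
      cycleWeight∈ {suc n′} n+1<k _ c =
          -- With n = n′ + 1, the least hexagon weight 4n + M equals `pathBase M n + n′`.
          n′ + toℕ c
        , <-≤-trans (+-monoʳ-< n′ (toℕ<n c)) (≤-trans (≤-reflexive (+-comm n′ 3)) n+1<k)
        , calc M n′ (toℕ c)
        where
        calc : ∀ M n′ c → suc n′ * 2 + suc n′ * 2 + M + c ≡ suc (M + 3 * suc n′) + (n′ + c)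
        calc = solve-∀

      pathWeight∈ : ∀ {a b} → suc (a + b) ≡ n → ∀ x → pathWeight M n a b x ∈ palette k
      pathWeight∈ {a} {b} eq = λ where
          (inj₁ 0F) → ∈-palette (n + b) (<-≤-trans (+-monoʳ-< n (pathIndex-< {i = a} eq 0F)) 2n≤k) refl
          (inj₁ 1F) → here refl
          (inj₁ 2F) → ∈-palette a (<-trans a<n n<k) refl
          (inj₂ 0F) → ∈-palette a (<-trans a<n n<k) refl
          (inj₂ 1F) → ∈-palette (suc a) (≤-<-trans a<n n<k) refl
        where
        a<n : a < n
        a<n = pathIndex-< {j = b} eq 1F
        n<k : n < k
        n<k = <-trans (n<1+n n) n+1<k

    weight∈palette : 0 < n → ∀ x → weight U g x ∈ palette k
    weight∈palette 0<n x with summand (m · C 6) H x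
    weight∈palette 0<n _ | inˡ y with copies-element (cycleLabel s m) 0 m y
    ... | a , b , _ , eq , z , _ , weight≡ with cycleWeight∈ n+1<k 0<n (cycleColour z)
    ... | t , t<k , eq′ =
      ∈-palette t t<k (trans (weight-⊹ˡ y) (trans weight≡ (trans (cycle-weight s eq z) eq′)))
    weight∈palette 0<n _ | inʳ y with H.labels-element y
    ... | a , b , eq , z , _ , weight≡ =
      subst (_∈ palette k) (sym (trans (weight-⊹ʳ {m · C 6} y) (trans weight≡ (path-weight M eq z))))
            (pathWeight∈ eq z)

    labeling-with-palette : 0 < n → Σ (Labeling U) λ f →
                            IsLocalTotalAntimagic U f × numberOfWeights U f ≤ suc k
    labeling-with-palette 0<n = f , proper⇒antimagic f (proper-≗ weight≡ g-proper) , (begin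
      numberOfWeights U f  ≤⟨ numberOfWeights-≤ f {palette k} weight∈ ⟩
      length (palette k)   ≡⟨ cong suc (trans (length-map _ (upTo k)) (length-upTo k)) ⟩
      suc k                ∎)
      where
      open ≤-Reasoning

      f : Labeling U
      f = proj₁ (toLabeling {U} {g} g-injective g-bounds)

      weight≡ : ∀ x → weight U (label U f) x ≡ weight U g x
      weight≡ = weight-≗ U (proj₂ (toLabeling {U} {g} g-injective g-bounds))

      weight∈ : ∀ x → weight U (label U f) x ∈ palette k
      weight∈ x = subst (_∈ palette k) (sym (weight≡ x)) (weight∈palette 0<n x)

-- Lower bounds from the leaves and centres of the paths.

-- In a disjoint union of copies of P₃, u is the leaf of e and v its centre.
LeafAndCentre : Graph → Set
LeafAndCentre H = ∀ (g : Element H → ℕ) → (∀ x → 0 < g x) → ∀ e →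
  (∃ λ u → weight H g (inj₁ u) ≡ g (inj₂ e)) × (∃ λ v → g (inj₂ e) < weight H g (inj₁ v))

P₃-leafAndCentre : LeafAndCentre (P 3)
P₃-leafAndCentre g pos 0F = (0F , +-identityʳ _) , 1F , m<m+n _ (<-≤-trans (pos (inj₂ 1F)) (m≤m+n _ 0))
P₃-leafAndCentre g pos 1F = (2F , +-identityʳ _) , 1F , <-≤-trans (m<n+m _ (pos (inj₂ 0F)))
                                                             (+-monoʳ-≤ (g (inj₂ 0F)) (m≤m+n _ 0))

⊕-leafAndCentre : ∀ {G H} → LeafAndCentre G → LeafAndCentre H → LeafAndCentre (G ⊕ H)
⊕-leafAndCentre {G} {H} lcG lcH g pos e with split (Graph.size G) e
... | left e′ =
  let φ = summandˡ G H
      weight≡ = Component.weight-element φ {g} (λ _ → refl)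
      (u , eq) , (v , lt) = lcG (g ∘ element φ) (pos ∘ element φ) e′
  in (_ , trans (weight≡ (inj₁ u)) eq) , (_ , <-≤-trans lt (≤-reflexive (sym (weight≡ (inj₁ v)))))
... | right e′ =
  let φ = summandʳ G H
      weight≡ = Component.weight-element φ {g} (λ _ → refl)
      (u , eq) , (v , lt) = lcH (g ∘ element φ) (pos ∘ element φ) e′
  in (_ , trans (weight≡ (inj₁ u)) eq) , (_ , <-≤-trans lt (≤-reflexive (sym (weight≡ (inj₁ v)))))

·-leafAndCentre : ∀ {G} k → LeafAndCentre G → LeafAndCentre (k · G)
·-leafAndCentre zero    lc g pos ()
·-leafAndCentre {G} (suc k) lc = ⊕-leafAndCentre {G} {k · G} lc (·-leafAndCentre k lc)

-- The count uses weights on the paths alone, so they enter as a component `G` of an arbitrary `K`.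
size<numberOfWeights : ∀ {G K} → Component G K → LeafAndCentre G → Graph.Edge G →
                       ∀ f → Graph.size G < numberOfWeights K f
size<numberOfWeights {G} {K} φ lc e₀ f = begin
  suc size                               ≡⟨ cong suc (length-tabulate id) ⟨
  suc (length (allFin size))             ≡⟨ cong suc (length-map g (allFin size)) ⟨
  length (centre ∷ map g (allFin size))  ≤⟨ ≤-numberOfWeights f unique weights∋ ⟩
  numberOfWeights K f                    ∎
  where
  open ≤-Reasoning
  open Graph G using (size)

  ℓ : Element G → ℕ
  ℓ = label K f ∘ element φ

  ℓ-positive : ∀ x → 0 < ℓ x
  ℓ-positive = label-positive {K} f ∘ element φ

  g : Graph.Edge G → ℕ
  g = ℓ ∘ inj₂

  weight≡ : ∀ x → weight K (label K f) (element φ x) ≡ weight G ℓ x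
  weight≡ = Component.weight-element φ (λ _ → refl)

  top : Graph.Edge G
  -- `e₀` is the default that `argmax` asks for in case of an empty list.
  top = argmax g e₀ (allFin size)

  centreVertex : ∃ λ v → g top < weight G ℓ (inj₁ v)
  centreVertex = proj₂ (lc ℓ ℓ-positive top)

  centre : ℕ
  centre = weight G ℓ (inj₁ (proj₁ centreVertex))

  g<centre : ∀ e → g e < centre
  g<centre e =
    ≤-<-trans (All.lookup (f[xs]≤f[argmax] e₀ (allFin size)) (∈-allFin e)) (proj₂ centreVertex)

  g-injective : ∀ {e e′} → g e ≡ g e′ → e ≡ e′
  g-injective eq =
    Component.edge-injective φ (inj₂-injective {A = Graph.Vertex K} (label-injective {K} f eq))

  unique : Unique (centre ∷ map g (allFin size))
  unique = All.tabulate (λ w∈ → apart w∈) ∷ Unique.map⁺ g-injective (Unique.allFin⁺ size)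
    where
    apart : ∀ {w} → w ∈ map g (allFin size) → centre ≢ w
    apart w∈ with ∈-map⁻ g w∈
    ... | e , _ , refl = <⇒≢ (g<centre e) ∘ sym

  weights∋ : ∀ {w} → w ∈ centre ∷ map g (allFin size) → ∃ λ x → weight K (label K f) x ≡ w
  weights∋ (here refl) = element φ (inj₁ (proj₁ centreVertex)) , weight≡ (inj₁ (proj₁ centreVertex))
  weights∋ (there w∈) with ∈-map⁻ g w∈
  ... | e , _ , refl =
    let (u , eq) , _ = lc ℓ ℓ-positive e in element φ (inj₁ u) , trans (weight≡ (inj₁ u)) eq

-- Three colours on a hexagon, and the lower bound for a single path.

module _ {a b c : ℕ} where
  private
    Colour : ℕ → Set
    Colour w = w ∈ a ∷ b ∷ c ∷ []

  -- Otherwise `p`, `q`, `r`, `s` would be four distinct members of a list of three.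
  fourth-colour : ∀ {p q r s} → Colour p → Colour q → Colour r → Colour s →
                  p ≢ q → p ≢ r → q ≢ r → q ≢ s → r ≢ s → p ≡ s
  fourth-colour {p} {q} {r} {s} p∈ q∈ r∈ s∈ p≢q p≢r q≢r q≢s r≢s with p ℕ.≟ s
  ... | yes p≡s = p≡s
  ... | no  p≢s = contradiction (unique-⊆⇒length-≤ distinct sub) (<⇒≱ ≤-refl)
    where
    distinct : Unique (p ∷ q ∷ r ∷ s ∷ [])
    distinct = (p≢q ∷ p≢r ∷ p≢s ∷ []) ∷ (q≢r ∷ q≢s ∷ []) ∷ (r≢s ∷ []) ∷ [] ∷ []
    sub : p ∷ q ∷ r ∷ s ∷ [] ⊆ a ∷ b ∷ c ∷ []
    sub = All.lookup (p∈ ∷ q∈ ∷ r∈ ∷ s∈ ∷ [])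

  -- If `c` were missed, three distinct values would fit into `a` and `b` alone.
  third-colour : ∀ {p q r} → Colour p → Colour q → Colour r → p ≢ q → p ≢ r → q ≢ r →
                 p ≡ c ⊎ q ≡ c ⊎ r ≡ c
  third-colour {p} {q} {r} p∈ q∈ r∈ p≢q p≢r q≢r with p ℕ.≟ c | q ℕ.≟ c | r ℕ.≟ c
  ... | yes p≡c | _ | _ = inj₁ p≡c
  ... | no _ | yes q≡c | _ = inj₂ (inj₁ q≡c)
  ... | no _ | no _ | yes r≡c = inj₂ (inj₂ r≡c)
  ... | no p≢c | no q≢c | no r≢c =
    contradiction (unique-⊆⇒length-≤ distinct
                    (All.lookup (lower p≢c p∈ ∷ lower q≢c q∈ ∷ lower r≢c r∈ ∷ [])))
                  (<⇒≱ ≤-refl)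
    where
    distinct : Unique (p ∷ q ∷ r ∷ [])
    distinct = (p≢q ∷ p≢r ∷ []) ∷ (q≢r ∷ []) ∷ [] ∷ []
    lower : ∀ {w} → w ≢ c → Colour w → w ∈ a ∷ b ∷ []
    lower _   (here eq) = here eq
    lower _   (there (here eq)) = there (here eq)
    lower w≢c (there (there (here eq))) = contradiction eq w≢c

-- `p` and `r` avoid `a + b` and differ from each other, so they are `a` and `b` in one order or the
-- other.
sum-of-others : ∀ {a b p q r} → p ∈ a ∷ b ∷ a + b ∷ [] → r ∈ a ∷ b ∷ a + b ∷ [] →
                q ≡ a + b → p ≢ q → r ≢ q → p ≢ r → p + r ≡ q
sum-of-others (here refl) (here refl) _ _ _ p≢r = contradiction refl p≢r
sum-of-others (here refl) (there (here refl)) q≡ _ _ _ = sym q≡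
sum-of-others {a} {b} (there (here refl)) (here refl) q≡ _ _ _ = trans (+-comm b a) (sym q≡)
sum-of-others (there (here refl)) (there (here refl)) _ _ _ p≢r = contradiction refl p≢r
sum-of-others (there (there (here refl))) _ q≡ p≢q _ _ = contradiction (sym q≡) p≢q
sum-of-others _ (there (there (here refl))) q≡ _ r≢q _ = contradiction (sym q≡) r≢q

-- With only the weights a, b, a + b on a hexagon, the edges on either side of an edge of
-- weight a + b have weights a and b; so the labels x, y, z, t of the four vertices
-- involved satisfy (x + y) + (z + t) = y + z, forcing x = t = 0.
module _ {g : Element (C 6) → ℕ} (g-positive : ∀ x → 0 < g x)
         (proper : Proper (C 6) (weight (C 6) g)) (a b : ℕ)
         (three : ∀ x → weight (C 6) g x ∈ a ∷ b ∷ a + b ∷ []) where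
  private
    open Graph (C 6)
    open Proper proper

    w : Element (C 6) → ℕ
    w = weight (C 6) g

    impossible : ∀ {x y z t} → 0 < x → (x + y) + (z + t) ≢ y + z
    impossible {x} {y} {z} {t} 0<x eq = <⇒≢ (begin-strict
      y + z              <⟨ m<n+m (y + z) 0<x ⟩
      x + (y + z)        ≤⟨ m≤m+n (x + (y + z)) t ⟩
      x + (y + z) + t    ≡⟨ calc x y z t ⟩
      (x + y) + (z + t)  ∎) (sym eq)
      where
      open ≤-Reasoning
      calc : ∀ x y z t → x + (y + z) + t ≡ (x + y) + (z + t)
      calc = solve-∀

    -- The edges `d`, `e`, `f` are consecutive, meeting at `u` and `v`. As `u`, `e`, `v` show all
    -- three colours, `f` has the colour of `u`, which the edge `d` at `u` cannot share. Thus `d`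
    -- and `f` carry the two colours other than that of `e`.
    flanking-sum : ∀ d u e v f → u ∈ᵉ d → u ∈ᵉ e → v ∈ᵉ e → v ∈ᵉ f → d ≢ e → e ≢ f → u ≢ v →
                   w (inj₂ e) ≡ a + b → w (inj₂ d) + w (inj₂ f) ≡ w (inj₂ e)
    flanking-sum d u e v f u∈d u∈e v∈e v∈f d≢e e≢f u≢v e≡a+b = sum-of-others
      (three (inj₂ d)) (three (inj₂ f)) e≡a+b
      (edges (d≢e , u , u∈d , u∈e)) (edges (e≢f , v , v∈e , v∈f) ∘ sym)
      λ d≡f → incident u∈d (trans u≡f (sym d≡f))
      where
      u≡f : w (inj₁ u) ≡ w (inj₂ f)
      u≡f = fourth-colour (three (inj₁ u)) (three (inj₂ e)) (three (inj₁ v)) (three (inj₂ f))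
              (incident u∈e) (vertices (u≢v , e , u∈e , v∈e)) (incident v∈e ∘ sym)
              (edges (e≢f , v , v∈e , v∈f)) (incident v∈f)

    e₀-light : w (inj₂ 0F) ≢ a + b
    e₀-light eq = impossible (g-positive (inj₁ 5F))
      (flanking-sum 5F 0F 0F 1F 1F (inj₂ refl) (inj₁ refl) (inj₂ refl) (inj₁ refl)
                    (λ ()) (λ ()) (λ ()) eq)

    e₁-light : w (inj₂ 1F) ≢ a + b
    e₁-light eq = impossible (g-positive (inj₁ 0F))
      (flanking-sum 0F 1F 1F 2F 2F (inj₂ refl) (inj₁ refl) (inj₂ refl) (inj₁ refl)
                    (λ ()) (λ ()) (λ ()) eq)

    e₂-light : w (inj₂ 2F) ≢ a + b
    e₂-light eq = impossible (g-positive (inj₁ 1F))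
      (flanking-sum 1F 2F 2F 3F 3F (inj₂ refl) (inj₁ refl) (inj₂ refl) (inj₁ refl)
                    (λ ()) (λ ()) (λ ()) eq)

    v₁≢v₂ : w (inj₁ 1F) ≢ w (inj₁ 2F)
    v₁≢v₂ = vertices ((λ ()) , 1F , inj₁ refl , inj₂ refl)

    e₀≢e₁ : w (inj₂ 0F) ≢ w (inj₂ 1F)
    e₀≢e₁ = edges ((λ ()) , 1F , inj₂ refl , inj₁ refl)

    e₁≢e₂ : w (inj₂ 1F) ≢ w (inj₂ 2F)
    e₁≢e₂ = edges ((λ ()) , 2F , inj₂ refl , inj₁ refl)

    -- With three colours, four consecutive elements of the hexagon, vertices and edges alternating,
    -- begin and end in the same colour.
    v₁≡e₂ : w (inj₁ 1F) ≡ w (inj₂ 2F)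
    v₁≡e₂ = fourth-colour (three (inj₁ 1F)) (three (inj₂ 1F)) (three (inj₁ 2F)) (three (inj₂ 2F))
              (incident (inj₁ refl)) v₁≢v₂ (incident (inj₂ refl) ∘ sym) e₁≢e₂ (incident (inj₁ refl))

    e₀≡v₂ : w (inj₂ 0F) ≡ w (inj₁ 2F)
    e₀≡v₂ = fourth-colour (three (inj₂ 0F)) (three (inj₁ 1F)) (three (inj₂ 1F)) (three (inj₁ 2F))
              (incident (inj₂ refl) ∘ sym) e₀≢e₁ (incident (inj₁ refl)) v₁≢v₂
              (incident (inj₂ refl) ∘ sym)

  -- One of v1, e1, v2 has weight `a + b`. If it is a vertex, that weight recurs on the edge e2 or
  -- e0; so some edge has it, which has been excluded.
  three-weights-impossible : ⊥
  three-weights-impossible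
    with third-colour (three (inj₁ 1F)) (three (inj₂ 1F)) (three (inj₁ 2F))
           (incident (inj₁ refl)) v₁≢v₂ (incident (inj₂ refl) ∘ sym)
  ... | inj₁ v₁≡         = e₂-light (trans (sym v₁≡e₂) v₁≡)
  ... | inj₂ (inj₁ e₁≡)  = e₁-light e₁≡
  ... | inj₂ (inj₂ v₂≡)  = e₀-light (trans e₀≡v₂ v₂≡)

-- The leaves and the centre of the path give three distinct weights. Any other weight makes four;
-- without one, the hexagon has only these three, a contradiction.
four≤numberOfWeights : ∀ {K} → Component (C 6) K → Component (P 3) K →
                       ∀ f → IsLocalTotalAntimagic K f → 4 ≤ numberOfWeights K f
four≤numberOfWeights {K} φ ψ f lta with 4 ℕ.≤? numberOfWeights K f
... | yes 4≤ = 4≤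
... | no  4≰ = ⊥-elim (three-weights-impossible (label-positive {K} f ∘ element φ)
    (proper-≗ (sym ∘ weight≡) (Component.restrict-proper φ (antimagic⇒proper f lta))) a b
    λ x → subst (_∈ a ∷ b ∷ a + b ∷ []) (weight≡ x) (three (element φ x)))
  where
  w : Element K → ℕ
  w = weight K (label K f)

  weight≡ : ∀ x → w (element φ x) ≡ weight (C 6) (label K f ∘ element φ) x
  weight≡ = Component.weight-element φ (λ _ → refl)

  g : Element (P 3) → ℕ
  g = label K f ∘ element ψ

  weight≡ᵖ : ∀ x → w (element ψ x) ≡ weight (P 3) g x
  weight≡ᵖ = Component.weight-element ψ (λ _ → refl)

  a b : ℕ
  a = g (inj₂ 0F)
  b = g (inj₂ 1F)

  path-weights : ∀ {t} → t ∈ a ∷ b ∷ a + b ∷ [] → ∃ λ x → w x ≡ t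
  path-weights (here refl) =
    element ψ (inj₁ 0F) , trans (weight≡ᵖ (inj₁ 0F)) (+-identityʳ a)
  path-weights (there (here refl)) =
    element ψ (inj₁ 2F) , trans (weight≡ᵖ (inj₁ 2F)) (+-identityʳ b)
  path-weights (there (there (here refl))) =
    element ψ (inj₁ 1F) , trans (weight≡ᵖ (inj₁ 1F)) (cong (a +_) (+-identityʳ b))

  a≢b : a ≢ b
  a≢b eq with Component.edge-injective ψ (inj₂-injective {A = Graph.Vertex K} (label-injective {K} f eq))
  ... | ()

  three : ∀ x → w x ∈ a ∷ b ∷ a + b ∷ []
  three x with w x ∈? (a ∷ b ∷ a + b ∷ [])
  ... | yes w∈ = w∈
  ... | no  w∉ = contradiction (≤-numberOfWeights f distinct all-weights) 4≰
    where
    distinct : Unique (w x ∷ a ∷ b ∷ a + b ∷ [])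
    distinct = All.tabulate (λ { t∈ refl → w∉ t∈ })
             ∷ (a≢b ∷ <⇒≢ (m<m+n a (s≤s z≤n)) ∷ []) ∷ (<⇒≢ (m<n+m b (s≤s z≤n)) ∷ []) ∷ [] ∷ []
    all-weights : ∀ {t} → t ∈ w x ∷ a ∷ b ∷ a + b ∷ [] → ∃ λ y → w y ≡ t
    all-weights (here refl) = x , refl
    all-weights (there t∈)  = path-weights t∈

theorem4p2 : ∀ (m n : ℕ) → 1 ≤ m → 2 ≤ n →
    (χₗₜ (m · C 6 ⊕ P 3) ≔ 4) × (χₗₜ (m · C 6 ⊕ n · P 3) ≔ (2 * n + 1))
theorem4p2 m@(suc m′) n@(suc n′) _ (s≤s 1≤n′) = one-path , many-paths
  where
  hexagons : Graph
  hexagons = m · C 6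

  one-path : χₗₜ (hexagons ⊕ P 3) ≔ 4
  one-path = χₗₜ-intro
    -- Here `k = 3`: the hexagon weights reach offset n + 1 = 2, one beyond the path weights, and
    -- the centre is the fourth weight.
    (labeling-with-palette m (singlePath ((m + m) * 6)) (s≤s (s≤s z≤n)) ≤-refl (s≤s z≤n))
    -- As `m` is a successor, there is a first hexagon to argue with.
    (four≤numberOfWeights (summandˡ hexagons (P 3) ∘ᶜ summandˡ (C 6) (m′ · C 6))
                         (summandʳ hexagons (P 3)))

  many-paths : χₗₜ (hexagons ⊕ n · P 3) ≔ (2 * n + 1)
  many-paths = χₗₜ-intro
    -- Here `k = n + n`; since n is at least 2, the largest hexagon offset n + 1 lies within the
    -- range of the leaf weights.
    (let f , lta , ≤2n+1 = labeling-with-palette m (manyPaths ((m + m) * 6) n) ≤-refl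
                             (s≤s (+-monoˡ-≤ n 1≤n′)) (s≤s z≤n)
     in f , lta , ≤-trans ≤2n+1 (≤-reflexive (double n)))
    λ f _ → begin
      2 * n + 1                                      ≡⟨ double′ n ⟩
      suc (n * 2)                                    ≡⟨ cong suc (size-· n (P 3)) ⟨
      suc (Graph.size (n · P 3))                     ≤⟨ size<numberOfWeights
                                                          (summandʳ hexagons (n · P 3))
                                                          (·-leafAndCentre n P₃-leafAndCentre) zero f ⟩
      numberOfWeights (hexagons ⊕ n · P 3) f         ∎
    where
    open ≤-Reasoning
    double : ∀ n → suc (n + n) ≡ 2 * n + 1
    double = solve-∀
    double′ : ∀ n → 2 * n + 1 ≡ suc (n * 2)
    double′ = solve-∀
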